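{- Let $m\in\mathbb{N}$ and let $p$ be a minimal idempotent in $(\beta\mathbb{N},+)$. Then for every $A\in\bigotimes_{i=1}^m p$ and every $T\in\mathcal{P}_f(\mathbb{P})$ there exist functions $\alpha:\mathcal{P}_f(\mathbb{N}^{\mathbb{N}})\to\mathbb{N}$ and $H:\mathcal{P}_f(\mathbb{N}^{\mathbb{N}})\to\mathcal{P}_f(\mathbb{N})$ such that (1) if $G,K\in\mathcal{P}_f(\mathbb{N}^{\mathbb{N}})$ and $G\subsetneq K$, then $H(G)<H(K)$; and (2) if $G_1\subsetneq G_2\subsetneq\cdots\subsetneq G_n\subsetneq\cdots$ is an infinite sequence in $\mathcal{P}_f(\mathbb{N}^{\mathbb{N}})$, then for all $\beta_1<\beta_2<\cdots<\beta_m$ in $\mathcal{P}_f(\mathbb{N})$, all $f_i\in G_i$ ($i\in\mathbb{N}$), and all $P_1,\ldots,P_m\in T$, $$\left(\sum_{i\in\beta_1}\alpha(G_i)+P_1\Bigl(\sum_{i\in\beta_1}\sum_{t\in H(G_i)}f_i(t)\Bigr),\ldots,\sum_{i\in\beta_m}\alpha(G_i)+P_m\Bigl(\sum_{i\in\beta_m}\sum_{t\in H(G_i)}f_i(t)\Bigr)\right)\in A.$$ In fact, the same holds for every idempotent $p$ of $(\mathcal{J}_p,+)$ (in place of a minimal idempotent).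
   Context: $\mathbb{N}$ is the set of positive integers; $\mathcal{P}_f(X)$ is the set of nonempty finite subsets of $X$; $\mathbb{N}^{\mathbb{N}}$ is the set of all functions $\mathbb{N}\to\mathbb{N}$. For $\beta,\gamma\in\mathcal{P}_f(\mathbb{N})$, $\beta<\gamma$ means $\max\beta<\min\gamma$. $\mathbb{P}$ is the set of one-variable polynomials with integer coefficients and zero constant term. $\beta\mathbb{N}$ is the set of ultrafilters on $\mathbb{N}$, with the Stone topology and the operation: $A\in p+q$ iff $\{x\in\mathbb{N}:-x+A\in q\}\in p$, where $-x+A=\{y\in\mathbb{N}:x+y\in A\}$. An ultrafilter $p$ is idempotent if $p+p=p$; a minimal idempotent is an idempotent lying in $K(\beta\mathbb{N},+)$, the smallest two-sided ideal (the union of all minimal left ideals) of $(\beta\mathbb{N},+)$. A set $A\subseteq\mathbb{N}$ is a $J_p$-set if for every $F\in\mathcal{P}_f(\mathbb{P})$ and every $H\in\mathcal{P}_f(\mathbb{N}^{\mathbb{N}})$ there exist $a\in\mathbb{N}$ and $\beta\in\mathcal{P}_f(\mathbb{N})$ such that $a+P(\sum_{t\in\beta}f(t))\in A$ for all $P\in F$ and $f\in H$. $\mathcal{J}_p=\{q\in\beta\mathbb{N}:\text{every }A\in q\text{ is a }J_p\text{ -set}\}$ (the subscript $p$ stands for "polynomial" and is not an ultrafilter); it is a two-sided ideal of $(\beta\mathbb{N},+)$. Tensor products: for ultrafilters $p_1,\ldots,p_k$ on $\mathbb{N}$, $\bigotimes_{i=1}^k p_i$ is the ultrafilter on $\mathbb{N}^k$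 defined recursively by $\bigotimes_{i=1}^1p_i=p_1$, and, for $A\subseteq\mathbb{N}^{k+1}$, $A\in\bigotimes_{i=1}^{k+1}p_i$ iff $\{(x_1,\ldots,x_k)\in\mathbb{N}^k:\{x_{k+1}\in\mathbb{N}:(x_1,\ldots,x_{k+1})\in A\}\in p_{k+1}\}\in\bigotimes_{i=1}^kp_i$. $\bigotimes_{i=1}^mp$ is the case $p_i=p$ for all $i$. -}

module Defs where

open import Level using (0ℓ) renaming (suc to lsuc)
open import Data.Fin using (Fin; zero; suc; fromℕ; inject₁)
open import Data.Integer using (ℤ; +_)
import Data.Integer as ℤ
open import Data.List using (List; []; _∷_; map; sum)
import Data.List.Membership.Propositional as List
open import Data.List.NonEmpty using (List⁺; toList; foldr₁)
import Data.List.NonEmpty as List⁺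
open import Data.List.Relation.Unary.Unique.Propositional using (Unique)
open import Data.Nat using (ℕ; zero; suc; NonZero; _+_; _<_; _⊔_; _⊓_)
open import Data.Product using (Σ; ∃-syntax; _×_; _,_)
open import Data.Sum using (_⊎_; inj₁; inj₂)
open import Data.Vec using (Vec; [_]; _∷ʳ_; lookup)
open import Function using (_∘_; _⇔_)
open import Relation.Binary.PropositionalEquality using (_≡_)
open import Relation.Nullary using (¬_)
open import Relation.Unary using (Pred; _∈_; _⊆_; _∩_; ∁; U; ∅)

------------------------------------------------------------------------
-- Positive integers

record ℕ⁺ : Set where
  constructor pos
  field
    val : ℕ
    .{{val≢0}} : NonZero val

open ℕ⁺ public using (val)

_+⁺_ : ℕ⁺ → ℕ⁺ → ℕ⁺
pos (suc m) +⁺ n = pos (suc (m + val n))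

suc⁺ : ℕ⁺ → ℕ⁺
suc⁺ n = pos (suc (val n))

------------------------------------------------------------------------
-- Nonempty finite subsets

-- A subset is enumerated without repetition, so that a sum over the
-- enumeration is the sum over the subset.  The enumeration order is
-- immaterial: equality of subsets is _≋_.  Elements are compared by _≡_,
-- which for functions is the intended equality under the function
-- extensionality assumed in the theorem.
record 𝒫f (X : Set) : Set where
  constructor mk𝒫f
  field
    elements : List⁺ X
    unique   : Unique (toList elements)

open 𝒫f public using (elements; unique)

module _ {X : Set} where

  infix 4 _∈f_ _⊆f_ _⊊f_ _≋_

  _∈f_ : X → 𝒫f X → Set
  x ∈f G = x List.∈ toList (elements G)

  _⊆f_ _⊊f_ _≋_ : 𝒫f X → 𝒫f X → Set
  G ⊆f K = ∀ {x} → x ∈f G → x ∈f K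
  G ⊊f K = G ⊆f K × ¬ (K ⊆f G)
  G ≋ K  = G ⊆f K × K ⊆f G

  ∑ : 𝒫f X → (X → ℕ) → ℕ
  ∑ G f = sum (map f (toList (elements G)))

  infix 5 ∑
  syntax ∑ G (λ x → e) = ∑[ x ∈ G ] e

max min : 𝒫f ℕ⁺ → ℕ
max β = foldr₁ _⊔_ (List⁺.map val (elements β))
min β = foldr₁ _⊓_ (List⁺.map val (elements β))

infix 4 _<f_

_<f_ : 𝒫f ℕ⁺ → 𝒫f ℕ⁺ → Set
β <f γ = max β < min γ

------------------------------------------------------------------------
-- Integer polynomials with zero constant term

-- The list c₁ ∷ c₂ ∷ … ∷ c_d ∷ [] stands for c₁x + c₂x² + … + c_d x^d.
ℙ : Set
ℙ = List ℤ

eval : ℙ → ℤ → ℤ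
eval []       x = + 0
eval (c ∷ cs) x = x ℤ.* (c ℤ.+ eval cs x)

------------------------------------------------------------------------
-- Ultrafilters

record Ultrafilter (X : Set) : Set₁ where
  infix 4 _∋_
  field
    _∋_      : Pred X 0ℓ → Set
    ∋-U      : _∋_ U
    ∌-∅      : ¬ (_∋_ ∅)
    upward   : ∀ {A B} → A ⊆ B → _∋_ A → _∋_ B
    ∋-∩      : ∀ {A B} → _∋_ A → _∋_ B → _∋_ (A ∩ B)
    ∋-or-∁   : ∀ A → _∋_ A ⊎ _∋_ (∁ A)

open Ultrafilter public

infix 4 _≈_

_≈_ : ∀ {X} → Ultrafilter X → Ultrafilter X → Set₁
p ≈ q = ∀ A → (p ∋ A) ⇔ (q ∋ A)

image : ∀ {X Y} → (X → Y) → Ultrafilter X → Ultrafilter Y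
image f p = record
  { _∋_    = λ A → p ∋ (λ x → f x ∈ A)
  ; ∋-U    = ∋-U p
  ; ∌-∅    = ∌-∅ p
  ; upward = λ A⊆B → upward p A⊆B
  ; ∋-∩    = ∋-∩ p
  ; ∋-or-∁ = λ A → ∋-or-∁ p (λ x → f x ∈ A)
  }

-- A ∈ combine _∙_ p q  iff  {x : {y : x ∙ y ∈ A} ∈ q} ∈ p.
combine : ∀ {X Y Z} → (X → Y → Z) → Ultrafilter X → Ultrafilter Y → Ultrafilter Z
combine {X} {Y} {Z} _∙_ p q = record
  { _∋_    = λ A → p ∋ section A
  ; ∋-U    = upward p (λ _ → ∋-U q) (∋-U p)
  ; ∌-∅    = λ h → ∌-∅ p (upward p (∌-∅ q) h)
  ; upward = λ A⊆B → upward p (upward q A⊆B)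
  ; ∋-∩    = λ a b → upward p (λ (s , t) → ∋-∩ q s t) (∋-∩ p a b)
  ; ∋-or-∁ = ultra
  }
  where
  section : Pred Z 0ℓ → Pred X 0ℓ
  section A x = q ∋ (λ y → (x ∙ y) ∈ A)

  section-∁ : ∀ A → ∁ (section A) ⊆ section (∁ A)
  section-∁ A {x} x∉ with ∋-or-∁ q (λ y → (x ∙ y) ∈ A)
  ... | inj₁ h with () ← x∉ h
  ... | inj₂ h = h

  ultra : ∀ A → (p ∋ section A) ⊎ (p ∋ section (∁ A))
  ultra A with ∋-or-∁ p (section A)
  ... | inj₁ h = inj₁ h
  ... | inj₂ h = inj₂ (upward p (section-∁ A) h)

-- The tensor product of the k+1 ultrafilters p 0, …, p k.
⨂ : ∀ k → (Fin (suc k) → Ultrafilter ℕ⁺) → Ultrafilter (Vec ℕ⁺ (suc k))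
⨂ zero    p = image [_] (p zero)
⨂ (suc k) p = combine _∷ʳ_ (⨂ k (p ∘ inject₁)) (p (fromℕ (suc k)))

------------------------------------------------------------------------
-- The semigroup (βℕ,+)

βℕ : Set₁
βℕ = Ultrafilter ℕ⁺

infixl 6 _⊕_

_⊕_ : βℕ → βℕ → βℕ
_⊕_ = combine _+⁺_

Idempotent : βℕ → Set₁
Idempotent p = p ⊕ p ≈ p

-- Ultrafilters are identified up to _≈_, so a subset of βℕ is a
-- predicate that respects it.
record LeftIdeal (L : Pred βℕ (lsuc 0ℓ)) : Set₁ where
  field
    respects : ∀ {p q} → p ≈ q → p ∈ L → q ∈ L
    nonempty : ∃[ p ] p ∈ L
    closed   : ∀ q {p} → p ∈ L → q ⊕ p ∈ L

MinimalLeftIdeal : Pred βℕ (lsuc 0ℓ) → Set₂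
MinimalLeftIdeal L = LeftIdeal L × (∀ L′ → LeftIdeal L′ → L′ ⊆ L → L ⊆ L′)

K[βℕ] : Pred βℕ (lsuc (lsuc 0ℓ))
K[βℕ] p = ∃[ L ] MinimalLeftIdeal L × p ∈ L

MinimalIdempotent : βℕ → Set₂
MinimalIdempotent p = Idempotent p × p ∈ K[βℕ]

------------------------------------------------------------------------
-- J_p-sets

infix 4 _∈ℤ_ _∈ℤ^_

-- The values a + P(…) are integers that need not be positive; lying in a
-- set of (tuples of) positive integers includes being positive.
_∈ℤ_ : ℤ → Pred ℕ⁺ 0ℓ → Set
z ∈ℤ A = ∃[ n ] n ∈ A × + val n ≡ z

_∈ℤ^_ : ∀ {m} → (Fin m → ℤ) → Pred (Vec ℕ⁺ m) 0ℓ → Set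
z ∈ℤ^ A = ∃[ x ] x ∈ A × (∀ j → + val (lookup x j) ≡ z j)

JpSet : Pred ℕ⁺ 0ℓ → Set
JpSet A =
  (F : 𝒫f ℙ) (H : 𝒫f (ℕ⁺ → ℕ⁺)) →
  ∃[ a ] Σ (𝒫f ℕ⁺) λ β →
    ∀ P f → P ∈f F → f ∈f H →
      (+ val a) ℤ.+ eval P (+ (∑[ t ∈ β ] val (f t))) ∈ℤ A

-- The subscript p stands for "polynomial"; it is not an ultrafilter.
𝒥p : Pred βℕ (lsuc 0ℓ)
𝒥p q = ∀ A → q ∋ A → JpSet A

{-# OPTIONS --safe #-}
module Submission where

-- Every member of a minimal idempotent is a J_p-set: it is piecewise syndetic, so the claim
-- reduces to a polynomial van der Waerden theorem along finite sums, which is proved by PET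
-- induction and colour focusing.  Let now p be an idempotent all of whose members are J_p-sets.
-- Call y a starred point of D ∈ p if y ∈ D and -y + D ∈ p; starred points form a member of p,
-- and so do the translates of that set by minus a starred point.  Writing A ∈ p ⊗ ... ⊗ p as
-- an iterated section, one builds α(F) and H(F) by recursion on |F|.  The chains below F leave
-- only finitely many partially built tuples, each asking the next increment to lie in a member
-- of p; as P(s + x) = P(s) + Q(x) with Q(0) = 0, a single application of the J_p-property of
-- the intersection of these members meets all demands.

open import Defs
open import Level using (0ℓ) renaming (suc to lsuc)
open import Axiom.ExcludedMiddle using (ExcludedMiddle)
open import Axiom.Extensionality.Propositional using (Extensionality)
open import Data.Bool using (Bool; true)
open import Data.Empty using (⊥; ⊥-elim)
open import Data.Fin using (Fin; zero; suc; toℕ; fromℕ; fromℕ<; inject₁; funToFin; finToFun)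
open import Data.Fin.Properties using (finToFun-funToFin; toℕ-fromℕ<) renaming (_≟_ to _≟ᶠ_)
open import Data.Fin.Relation.Unary.Top using (view; ‵fromℕ; ‵inject₁)
open import Data.Integer
  using (ℤ; +_; -[1+_]; 0ℤ; -1ℤ; ∣_∣; _+_; _-_; _*_; -_; +<+; +≤+)
import Data.Integer as ℤ
import Data.Integer.Properties as ℤₚ
open import Data.Integer.Tactic.RingSolver using (solve-∀)
open import Data.List
  using (List; []; _∷_; _++_; map; length; lookup; concat; cartesianProduct; cartesianProductWith; allFin)
import Data.List.Membership.DecPropositional as DecMembership
open import Data.List.Membership.Propositional using () renaming (_∈_ to _∈ₗ_)
open import Data.List.Membership.Propositional.Properties
  using (∈-∃++; ∈-++⁺ˡ; ∈-++⁺ʳ; ∈-++⁻; ∈-map⁺; ∈-map⁻; ∈-concat⁺′; ∈-allFin; ∈-deduplicate⁺;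
         ∈-cartesianProduct⁺; ∈-cartesianProduct⁻; ∈-cartesianProductWith⁺)
open import Data.List.NonEmpty using (toList; foldr₁)
import Data.List.NonEmpty as List⁺
open import Data.List.Properties using (length-tabulate; length-map; length-++; map-++; map-∘; ∷-injective)
open import Data.List.Relation.Binary.Permutation.Propositional using (_↭_; ↭⇒↭ₛ; ↭-sym)
open import Data.List.Relation.Binary.Permutation.Propositional.Properties
  using (∈-resp-↭) renaming (map⁺ to ↭-map⁺)
open import Data.List.Relation.Binary.Permutation.Setoid.Properties using (Unique-resp-↭)
open import Data.List.Relation.Binary.Subset.Propositional using () renaming (_⊆_ to _⊆ₗ_)
open import Data.List.Relation.Unary.All as All using (All; []; _∷_)
import Data.List.Relation.Unary.All.Properties as Allₚ
open import Data.List.Relation.Unary.AllPairs as AllPairs using (AllPairs; []; _∷_)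
open import Data.List.Relation.Unary.Any as Any using (Any; here; there; index)
open import Data.List.Relation.Unary.Any.Properties using (lookup-index)
open import Data.List.Relation.Unary.Sorted.TotalOrder.Properties using (Sorted⇒AllPairs)
open import Data.List.Relation.Unary.Unique.DecPropositional.Properties using (deduplicate-!)
open import Data.List.Relation.Unary.Unique.Propositional using (Unique)
open import Data.List.Relation.Unary.Unique.Propositional.Properties
  using () renaming (map⁺ to Unique-map⁺; ++⁺ to Unique-++⁺)
import Data.List.Sort
open import Data.Nat using (ℕ; zero; suc; _≤_; _<_; _⊔_; _⊓_; _^_; z≤n; s≤s)
import Data.Nat as ℕ
open import Data.Nat.ListAction using (sum)
open import Data.Nat.ListAction.Properties using (sum-++; sum-↭)
import Data.Nat.Properties as ℕₚ
open import Data.Product using (Σ; ∃; ∃-syntax; _×_; _,_; proj₁; proj₂)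
open import Data.Sum using (_⊎_; inj₁; inj₂; [_,_]′)
open import Data.Unit using (⊤; tt)
open import Data.Vec as Vec using (Vec; _∷ʳ_)
open import Function using (_∘_; id; Equivalence; mk⇔)
open import Function.Definitions using (Congruent)
import Relation.Binary.Construct.On as On
open import Relation.Binary.PropositionalEquality
  using (_≡_; refl; sym; trans; cong; cong₂; subst; setoid; module ≡-Reasoning)
open import Relation.Nullary using (Dec; ¬_; yes; no; does)
open import Relation.Nullary.Decidable using (decidable-stable; does-⇔; recompute; dec-true)
open import Relation.Unary using (Pred; _∈_; _∪_)

open Equivalence using (to; from)

-- Lists and positive integers

-- Pigeonhole: it bounds the number of distinct colours and makes proper subsets shorter.
Unique-⊆-length : ∀ {X : Set} {xs ys : List X} → Unique xs → xs ⊆ₗ ys → length xs ≤ length ys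
Unique-⊆-length {xs = []} _ _ = z≤n
Unique-⊆-length {xs = x ∷ xs} (x∉xs ∷ u) sub with ∈-∃++ (sub (here refl))
... | as , bs , refl = ℕₚ.≤-trans (s≤s (Unique-⊆-length u sub′)) (ℕₚ.≤-reflexive eq)
  where
  sub′ : xs ⊆ₗ as ++ bs
  sub′ {y} y∈ with ∈-++⁻ as (sub (there y∈))
  ... | inj₁ y∈as = ∈-++⁺ˡ y∈as
  ... | inj₂ (here y≡x) = ⊥-elim (All.lookup x∉xs y∈ (sym y≡x))
  ... | inj₂ (there y∈bs) = ∈-++⁺ʳ as y∈bs
  eq : suc (length (as ++ bs)) ≡ length (as ++ x ∷ bs)
  eq = begin
    suc (length (as ++ bs))        ≡⟨ cong suc (length-++ as) ⟩
    suc (length as ℕ.+ length bs)  ≡⟨ ℕₚ.+-suc (length as) (length bs) ⟨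
    length as ℕ.+ length (x ∷ bs)  ≡⟨ length-++ as ⟨
    length (as ++ x ∷ bs)          ∎
    where open ≡-Reasoning

∈⇒≤sum : ∀ {X : Set} (f : X → ℕ) {x xs} → x ∈ₗ xs → f x ≤ sum (map f xs)
∈⇒≤sum f {xs = y ∷ ys} (here refl) = ℕₚ.m≤m+n (f y) _
∈⇒≤sum f {xs = y ∷ ys} (there x∈)  = ℕₚ.≤-trans (∈⇒≤sum f x∈) (ℕₚ.m≤n+m _ (f y))

val-injective : ∀ {m n : ℕ⁺} → val m ≡ val n → m ≡ n
val-injective {pos _} {pos _} refl = refl

val-+⁺ : ∀ m n → val (m +⁺ n) ≡ val m ℕ.+ val n
val-+⁺ (pos (suc m)) n = refl

0<val : ∀ n → 0 < val n
0<val (pos (suc n)) = s≤s z≤n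

+⁺-assoc : ∀ l m n → (l +⁺ m) +⁺ n ≡ l +⁺ (m +⁺ n)
+⁺-assoc l m n = val-injective (begin
  val ((l +⁺ m) +⁺ n)          ≡⟨ val-+⁺ (l +⁺ m) n ⟩
  val (l +⁺ m) ℕ.+ val n       ≡⟨ cong (ℕ._+ val n) (val-+⁺ l m) ⟩
  val l ℕ.+ val m ℕ.+ val n    ≡⟨ ℕₚ.+-assoc (val l) (val m) (val n) ⟩
  val l ℕ.+ (val m ℕ.+ val n)  ≡⟨ cong (val l ℕ.+_) (val-+⁺ m n) ⟨
  val l ℕ.+ val (m +⁺ n)       ≡⟨ val-+⁺ l (m +⁺ n) ⟨
  val (l +⁺ (m +⁺ n))          ∎)
  where open ≡-Reasoning

+⁺-comm : ∀ m n → m +⁺ n ≡ n +⁺ m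
+⁺-comm m n = val-injective (begin
  val (m +⁺ n)     ≡⟨ val-+⁺ m n ⟩
  val m ℕ.+ val n  ≡⟨ ℕₚ.+-comm (val m) (val n) ⟩
  val n ℕ.+ val m  ≡⟨ val-+⁺ n m ⟨
  val (n +⁺ m)     ∎)
  where open ≡-Reasoning

toℕ⁺ : ℤ → ℕ⁺
toℕ⁺ (+ suc n) = pos (suc n)
toℕ⁺ _         = pos 1

val-toℕ⁺ : ∀ {i} → 0ℤ ℤ.< i → + val (toℕ⁺ i) ≡ i
val-toℕ⁺ {+ suc n} _ = refl
val-toℕ⁺ {+ zero} (+<+ ())

positive-translate : ∀ (W : List ℤ) → ∃[ z ] ∀ {w} → w ∈ₗ W → 0ℤ ℤ.< + z + w
positive-translate W = suc (sum (map ∣_∣ W)) , λ {w} w∈ →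
  ℤₚ.<-≤-trans (0<suc∣w∣+w w) (ℤₚ.+-monoˡ-≤ w (+≤+ (s≤s (∈⇒≤sum ∣_∣ w∈))))
  where
  0<suc∣w∣+w : ∀ w → 0ℤ ℤ.< + suc ∣ w ∣ + w
  0<suc∣w∣+w (+ n)    = +<+ (s≤s z≤n)
  0<suc∣w∣+w -[1+ n ] = subst (0ℤ ℤ.<_)
    (sym (trans (ℤₚ.⊖-≥ (ℕₚ.n≤1+n (suc n))) (cong +_ (ℕₚ.m+n∸n≡m 1 (suc n)))))
    (+<+ (s≤s z≤n))

-- Polynomial maps and monochromatic polynomial configurations

module Polynomials {V : Set} (_∙_ : V → V → V) where

  private variable
    d : ℕ
    φ ψ : V → ℤ

  shift : V → (V → ℤ) → V → ℤ
  shift u φ v = φ (u ∙ v) - φ u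

  -- Degree at most `d` without constant term, measured by the mixed difference φ(u ∙ v) - φ u - φ
  -- v; degree one is additivity.
  data Poly : ℕ → Pred (V → ℤ) 0ℓ where
    null  : (∀ v → φ v ≡ 0ℤ) → Poly zero φ
    deriv : (∀ u → Poly d (λ v → shift u φ v - φ v)) → Poly (suc d) φ

  Poly-resp : (∀ v → φ v ≡ ψ v) → Poly d φ → Poly d ψ
  Poly-resp eq (null p)  = null λ v → trans (sym (eq v)) (p v)
  Poly-resp eq (deriv p) = deriv λ u →
    Poly-resp (λ v → cong₂ _-_ (cong₂ _-_ (eq (u ∙ v)) (eq u)) (eq v)) (p u)

  Poly-+ : Poly d φ → Poly d ψ → Poly d (λ v → φ v + ψ v)
  Poly-+ (null p)  (null q)  = null λ v → cong₂ _+_ (p v) (q v)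
  Poly-+ {φ = φ} {ψ = ψ} (deriv p) (deriv q) = deriv λ u →
    Poly-resp (λ v → identity (φ (u ∙ v)) (φ u) (φ v) (ψ (u ∙ v)) (ψ u) (ψ v)) (Poly-+ (p u) (q u))
    where
    identity : ∀ a b c a′ b′ c′ →
      ((a - b) - c) + ((a′ - b′) - c′) ≡ ((a + a′) - (b + b′)) - (c + c′)
    identity = solve-∀

  Poly-* : ∀ k → Poly d φ → Poly d (λ v → k * φ v)
  Poly-* k (null p)  = null λ v → trans (cong (k *_) (p v)) (ℤₚ.*-zeroʳ k)
  Poly-* k (deriv p) = deriv λ u → Poly-resp (λ v → identity k _ _ _) (Poly-* k (p u))
    where
    identity : ∀ k a b c →
      k * ((a - b) - c) ≡ ((k * a) - (k * b)) - (k * c)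
    identity = solve-∀

  Poly-neg : Poly d φ → Poly d (λ v → - φ v)
  Poly-neg p = Poly-resp (λ v → ℤₚ.-1*i≡-i _) (Poly-* -1ℤ p)

  Poly-- : Poly d φ → Poly d ψ → Poly d (λ v → φ v - ψ v)
  Poly-- p q = Poly-+ p (Poly-neg q)

  Poly-0 : Poly d (λ _ → 0ℤ)
  Poly-0 {zero}  = null λ _ → refl
  Poly-0 {suc d} = deriv λ _ → Poly-0

  Poly-suc : Poly d φ → Poly (suc d) φ
  Poly-suc (null p)  = deriv λ u → null λ v →
    cong₂ _-_ (cong₂ _-_ (p (u ∙ v)) (p u)) (p v)
  Poly-suc (deriv p) = deriv λ u → Poly-suc (p u)

  Additive : Pred (V → ℤ) 0ℓ
  Additive χ = ∀ u v → χ (u ∙ v) ≡ χ u + χ v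

  -- A Horner step of `eval`. With δ the mixed difference of φ at u, that of χ * (k + φ) is χ u * (φ
  -- + δ) + χ * (φ u + δ); the second summand has the same form again, with constant φ u.
  Poly-additive-* : ∀ {χ} → Additive χ → ∀ k → Poly d φ →
                    Poly (suc d) (λ v → χ v * (k + φ v))
  Poly-additive-* {φ = φ} {χ = χ} add k (null p) = deriv λ u → null λ v →
    let open ≡-Reasoning in begin
    (χ (u ∙ v) * (k + φ (u ∙ v)) - χ u * (k + φ u)) - χ v * (k + φ v)
      ≡⟨ cong₂ _-_ (cong₂ _-_ (cong₂ (λ a x → a * (k + x)) (add u v) (p (u ∙ v)))
                                  (cong (λ x → χ u * (k + x)) (p u)))
                     (cong (λ x → χ v * (k + x)) (p v)) ⟩
    ((χ u + χ v) * (k + 0ℤ) - χ u * (k + 0ℤ)) - χ v * (k + 0ℤ)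
      ≡⟨ identity k (χ u) (χ v) ⟩
    0ℤ ∎
    where
    identity : ∀ k a b →
      ((a + b) * (k + 0ℤ) - a * (k + 0ℤ)) - b * (k + 0ℤ) ≡ 0ℤ
    identity = solve-∀
  Poly-additive-* {φ = φ} {χ = χ} add k (deriv p) = deriv λ u →
    Poly-resp
      (λ v → trans
        (identity k (χ u) (χ v) (φ (u ∙ v)) (φ u) (φ v))
        (cong (λ a → (a * (k + φ (u ∙ v)) - χ u * (k + φ u)) - χ v * (k + φ v))
              (sym (add u v))))
      (Poly-+ (Poly-* (χ u) (Poly-+ {φ = φ} (deriv p) (Poly-suc (p u))))
              (Poly-additive-* {χ = χ} add (φ u) (p u)))
    where
    identity : ∀ k a b x y z →
      a * (z + ((x - y) - z)) + b * (y + ((x - y) - z)) ≡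
      ((a + b) * (k + x) - a * (k + y)) - b * (k + z)
    identity = solve-∀

  Poly-eval : ∀ {χ} → Additive χ → ∀ P → Poly (length P) (eval P ∘ χ)
  Poly-eval add []       = null λ _ → refl
  Poly-eval {χ} add (c ∷ cs) = Poly-additive-* {χ = χ} add c (Poly-eval {χ} add cs)

  Poly-≤ : ∀ {e} → d ≤ e → Poly d φ → Poly e φ
  Poly-≤ {e = zero}  z≤n p = p
  Poly-≤ {e = suc e} d≤e p with ℕₚ.m≤n⇒m<n∨m≡n d≤e
  ... | inj₁ (s≤s d≤e′) = Poly-suc (Poly-≤ d≤e′ p)
  ... | inj₂ refl       = p

-- Colour focusing and PET induction

module Colouring
  {V : Set} (_∙_ : V → V → V) (Block : ℕ → V → Set) (top : V → ℕ)
  (inhabited : ∀ l → ∃ (Block l))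
  (weaken : ∀ {l m v} → l ≤ m → Block m v → Block l v)
  (join : ∀ {l m u v} → l ≤ m → Block l u → top u ≤ m → Block m v → Block l (u ∙ v))
  where

  open Polynomials _∙_

  Mono : ∀ {r} → (ℤ → Fin r) → List (V → ℤ) → ℤ → V → Set
  Mono c Φ a u = All (λ φ → c (a + φ u) ≡ c a) Φ

  -- The finite sets A and U serve all colourings at once; this uniformity makes it possible to
  -- colour ℤ by the patterns on a finite window.
  Good : Pred (List (V → ℤ)) 0ℓ
  Good Φ = ∀ r l → ∃[ A ] ∃[ U ] All (Block l) U ×
    (∀ (c : ℤ → Fin r) → ∃[ a ] ∃[ u ] a ∈ₗ A × u ∈ₗ U × Mono c Φ a u)

  window : List ℤ → List V → List (V → ℤ) → List ℤ
  window A U Φ = A ++ cartesianProductWith _+_ A (cartesianProductWith id Φ U)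

  ∈-window₀ : ∀ {A} U Φ {a} → a ∈ₗ A → a ∈ₗ window A U Φ
  ∈-window₀ U Φ a∈ = ∈-++⁺ˡ a∈

  ∈-window : ∀ {A U Φ a u φ} → a ∈ₗ A → u ∈ₗ U → φ ∈ₗ Φ → a + φ u ∈ₗ window A U Φ
  ∈-window {A} a∈ u∈ φ∈ = ∈-++⁺ʳ A
    (∈-cartesianProductWith⁺ _+_ a∈ (∈-cartesianProductWith⁺ id φ∈ u∈))

  pattern-colouring : ∀ {r} (W : List ℤ) → (ℤ → Fin r) → ℤ → Fin (r ^ length W)
  pattern-colouring W c z = funToFin λ i → c (z + lookup W i)

  pattern-colouring-≡ : ∀ {r} (W : List ℤ) (c : ℤ → Fin r) z z′ →
    pattern-colouring W c z ≡ pattern-colouring W c z′ →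
    ∀ {w} → w ∈ₗ W → c (z + w) ≡ c (z′ + w)
  pattern-colouring-≡ W c z z′ eq w∈ = begin
    c (z + _)                              ≡⟨ cong (λ w → c (z + w)) (lookup-index w∈) ⟩
    c (z + lookup W i)                     ≡⟨ finToFun-funToFin (λ j → c (z + lookup W j)) i ⟨
    finToFun (pattern-colouring W c z) i   ≡⟨ cong (λ κ → finToFun κ i) eq ⟩
    finToFun (pattern-colouring W c z′) i  ≡⟨ finToFun-funToFin (λ j → c (z′ + lookup W j)) i ⟩
    c (z′ + lookup W i)                    ≡⟨ cong (λ w → c (z′ + w)) (lookup-index w∈) ⟨
    c (z′ + _)                             ∎
    where
    open ≡-Reasoning
    i = index w∈

  -- `φ - ψ` serves the new focus `w`, and `shift u φ - ψ` the focus `u ∙ w` that prolongs an old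
  -- one.
  variants : List V → List (V → ℤ) → (V → ℤ) → List (V → ℤ)
  variants U Φ ψ = map (λ χ v → χ v - ψ v) (Φ ++ cartesianProductWith shift U Φ)

  ∈-variants₀ : ∀ U {Φ} ψ {φ} → φ ∈ₗ Φ → (λ v → φ v - ψ v) ∈ₗ variants U Φ ψ
  ∈-variants₀ U ψ φ∈ = ∈-map⁺ _ (∈-++⁺ˡ φ∈)

  ∈-variants : ∀ {U Φ} ψ {u φ} → u ∈ₗ U → φ ∈ₗ Φ → (λ v → shift u φ v - ψ v) ∈ₗ variants U Φ ψ
  ∈-variants {U} {Φ} ψ u∈ φ∈ = ∈-map⁺ _ (∈-++⁺ʳ Φ (∈-cartesianProductWith⁺ shift u∈ φ∈))

  -- The colours of the foci differ from each other and from that of `a`, so there are fewer than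
  -- `r` foci.
  Focused : ∀ {r} → (ℤ → Fin r) → List (V → ℤ) → List V → ℕ → ℤ → Set
  Focused {r} c Φ U s a = Σ (List (V × Fin r)) λ foci →
    length foci ≡ s ×
    All (λ (u , κ) → u ∈ₗ U × All (λ φ → c (a + φ u) ≡ κ) Φ) foci ×
    Unique (c a ∷ map proj₂ foci)

  module _ {Φ : List (V → ℤ)} {ψ : V → ℤ} (good : ∀ U → Good (variants U Φ ψ)) where

    -- A new focus: if the pattern on the window of the first s foci repeats at all b + χ w with
    -- χ in variants U Φ ψ, then a + b - ψ w is a focus for the joined blocks u ∙ w and for w itself.
    focus : ∀ r l s → ∃[ A ] ∃[ U ] All (Block l) U ×
      (∀ (c : ℤ → Fin r) → (∃[ a ] ∃[ u ] a ∈ₗ A × u ∈ₗ U × Mono c Φ a u)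
                         ⊎ (∃[ a ] a ∈ₗ A × Focused c Φ U s a))
    focus r l zero = 0ℤ ∷ [] , [] , [] , λ c →
      inj₂ (0ℤ , here refl , [] , refl , [] , [] ∷ [])
    focus r l (suc s) with focus r l s
    ... | A , U , U-blocks , foc
      -- One colour per pattern on the window; the level dominates `l` and every `top u`, as `join`
      -- demands.
      with good U (r ^ length (window A U Φ)) (l ℕ.+ sum (map top U))
    ... | B , U′ , U′-blocks , mono = A″ , U″ , U″-blocks , result
      where
      W = window A U Φ
      A″ = cartesianProductWith _+_ B A ++
           cartesianProductWith (λ x w → x - ψ w) (cartesianProductWith _+_ A B) U′
      U″ = U ++ (U′ ++ cartesianProductWith _∙_ U U′)
      U″-blocks : All (Block l) U″
      U″-blocks = Allₚ.++⁺ U-blocks (Allₚ.++⁺ (All.map (weaken (ℕₚ.m≤m+n l _)) U′-blocks)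
        (Allₚ.cartesianProductWith⁺ (setoid V) (setoid V) _∙_ U U′ λ u∈ w∈ →
          join (ℕₚ.m≤m+n l _) (All.lookup U-blocks u∈)
               (ℕₚ.≤-trans (∈⇒≤sum top u∈) (ℕₚ.m≤n+m _ l))
               (All.lookup U′-blocks w∈)))
      result : ∀ c → _
      result c with mono (pattern-colouring W c)
      ... | b , w , b∈ , w∈ , same
        -- The old foci are sought in the colouring as seen from `b`.
        with foc (λ z → c (b + z))
      ... | inj₁ (a , u , a∈ , u∈ , m) =
        inj₁ (b + a , u , ∈-++⁺ˡ (∈-cartesianProductWith⁺ _+_ b∈ a∈) , ∈-++⁺ˡ u∈ ,
              All.map (trans (cong c (ℤₚ.+-assoc b a _))) m)
      ... | inj₂ (a , a∈ , foci , len , mono-foci , uniq) = conclude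
        where
        a′ = a + b - ψ w
        a′∈ : a′ ∈ₗ A″
        a′∈ = ∈-++⁺ʳ (cartesianProductWith _+_ B A)
          (∈-cartesianProductWith⁺ (λ x w → x - ψ w) (∈-cartesianProductWith⁺ _+_ a∈ b∈) w∈)
        copy : ∀ χ → (λ v → χ v - ψ v) ∈ₗ variants U Φ ψ →
               ∀ {x} → x ∈ₗ W → c (b + (χ w - ψ w) + x) ≡ c (b + x)
        copy χ χ∈ = pattern-colouring-≡ W c (b + (χ w - ψ w)) b (All.lookup same χ∈)
        foci′ : List (V × Fin r)
        -- From `a′`, the block `w` alone leads to copies of the point `b + a`, and the joined
        -- blocks lead to copies of the points of the old foci.
        foci′ = (w , c (b + a)) ∷ map (λ (u , κ) → u ∙ w , κ) foci
        old : ∀ {u κ} → u ∈ₗ U × All (λ φ → c (b + (a + φ u)) ≡ κ) Φ →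
              u ∙ w ∈ₗ U″ × All (λ φ → c (a′ + φ (u ∙ w)) ≡ κ) Φ
        old {u} (u∈ , m) =
          ∈-++⁺ʳ U (∈-++⁺ʳ U′ (∈-cartesianProductWith⁺ _∙_ u∈ w∈)) ,
          All.tabulate λ {φ} φ∈ →
            trans (cong c (identity a b (ψ w) (φ u) (φ (u ∙ w))))
            (trans (copy (shift u φ) (∈-variants ψ u∈ φ∈) (∈-window a∈ u∈ φ∈)) (All.lookup m φ∈))
          where
          identity : ∀ a b y p q → a + b - y + q ≡ b + (q - p - y) + (a + p)
          identity = solve-∀
        mono-foci′ : All (λ (u , κ) → u ∈ₗ U″ × All (λ φ → c (a′ + φ u) ≡ κ) Φ) foci′
        mono-foci′ =
          (∈-++⁺ʳ U (∈-++⁺ˡ w∈) , All.tabulate λ {φ} φ∈ →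
            trans (cong c (identity a b (ψ w) (φ w)))
                  (copy φ (∈-variants₀ U ψ φ∈) (∈-window₀ U Φ a∈)))
          ∷ Allₚ.map⁺ (All.map old mono-foci)
          where
          identity : ∀ a b y p → a + b - y + p ≡ b + (p - y) + a
          identity = solve-∀
        conclude : _ ⊎ _
        -- A focus with the colour of `a′` completes a monochromatic configuration; otherwise `a′`
        -- and its foci show `s + 2` different colours.
        conclude with DecMembership._∈?_ _≟ᶠ_ (c a′) (map proj₂ foci′)
        ... | no c∉ = inj₂ (a′ , a′∈ , foci′ , cong suc (trans (length-map _ foci) len) , mono-foci′ ,
                Allₚ.¬Any⇒All¬ _ c∉ ∷ subst (λ κs → Unique (c (b + a) ∷ κs)) (map-∘ foci) uniq)
        ... | yes c∈ with ∈-map⁻ proj₂ c∈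
        ...   | (u , κ) , uκ∈ , c≡κ with All.lookup mono-foci′ uκ∈
        ...     | u∈ , m = inj₁ (a′ , u , a′∈ , u∈ , All.map (λ eq → trans eq (sym c≡κ)) m)

    -- With `r` foci, the foci and their base point would show `r + 1` of `r` colours.
    focusing : Good Φ
    focusing r l with focus r l r
    ... | A , U , blocks , foc = A , U , blocks , λ c → finish c (foc c)
      where
      finish : ∀ c → _ ⊎ _ → _
      finish c (inj₁ m) = m
      finish c (inj₂ (a , _ , foci , len , _ , uniq)) = ⊥-elim (ℕₚ.<-irrefl refl (begin-strict
        r                                 ≡⟨ len ⟨
        length foci                       ≡⟨ length-map proj₂ foci ⟨
        length (map proj₂ foci)           <⟨ Unique-⊆-length uniq (λ {κ} _ → ∈-allFin κ) ⟩
        length (allFin r)                 ≡⟨ length-tabulate id ⟩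
        r                                 ∎))
        where open ℕₚ.≤-Reasoning

  GoodSet : Pred (V → ℤ) 0ℓ → Set
  GoodSet Θ = ∀ Φ → All Θ Φ → Good Φ

  -- `variants` arises by shifts and subtractions; this property and `ShiftClosed` keep a class
  -- stable under both.
  Invariant : ℕ → Pred (V → ℤ) 0ℓ → Set
  Invariant d Θ = ∀ {φ γ} → φ ∈ Θ → Poly d γ → (λ v → φ v + γ v) ∈ Θ

  ShiftClosed : Pred (V → ℤ) 0ℓ → Set
  ShiftClosed Θ = ∀ {φ} u → φ ∈ Θ → shift u φ ∈ Θ

  Near : ℕ → List (V → ℤ) → (V → ℤ) → Pred (V → ℤ) 0ℓ
  Near d Ψ ω φ = Any (λ ψ → Poly d (λ v → φ v - (ψ v - ω v))) Ψ

  good-null : ∀ {Θ} → GoodSet Θ → GoodSet (Θ ∪ Poly 0)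
  good-null {Θ} good Φ Φ⊆ r l with keep Φ Φ⊆
    where
    keep : ∀ Φ → All (Θ ∪ Poly 0) Φ →
      ∃[ Φ′ ] All Θ Φ′ × (∀ {r} (c : ℤ → Fin r) a u → Mono c Φ′ a u → Mono c Φ a u)
    keep [] [] = [] , [] , λ _ _ _ _ → []
    keep (φ ∷ Φ) (inj₁ φ∈ ∷ Φ⊆) with keep Φ Φ⊆
    ... | Φ′ , Φ′⊆ , m = φ ∷ Φ′ , φ∈ ∷ Φ′⊆ , λ { c a u (h ∷ hs) → h ∷ m c a u hs }
    keep (φ ∷ Φ) (inj₂ (null φ≡0) ∷ Φ⊆) with keep Φ Φ⊆
    ... | Φ′ , Φ′⊆ , m = Φ′ , Φ′⊆ , λ c a u hs →
      cong c (trans (cong (λ x → a + x) (φ≡0 u)) (ℤₚ.+-identityʳ a)) ∷ m c a u hs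
  ... | Φ′ , Φ′⊆ , m with good Φ′ Φ′⊆ r l
  ... | A , U , blocks , f = A , U , blocks , λ c →
    let a , u , a∈ , u∈ , h = f c in a , u , a∈ , u∈ , m c a u h

  -- PET induction: modulo Poly d, the elements of Poly (suc d) fall into finitely many classes.
  -- Subtracting a representative ψ, as focusing does, turns the class of ψ into elements of
  -- Poly d, which the hypothesis on d absorbs, and keeps the number of the other classes.
  good-∪-Poly : ∀ d {Θ} → Invariant d Θ → ShiftClosed Θ →
                GoodSet Θ → GoodSet (Θ ∪ Poly d)
  good-∪-Poly zero inv sh good = good-null good
  good-∪-Poly (suc d) {Θ} inv sh good Φ Φ⊆ =
    let Ψ , Ψ⊆ , Φ⊆′ = split Φ Φ⊆ in classes Ψ (λ _ → 0ℤ) Ψ⊆ Poly-0 Φ Φ⊆′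
    where
    split : ∀ Φ → All (Θ ∪ Poly (suc d)) Φ →
      ∃[ Ψ ] All (Poly (suc d)) Ψ × All (Θ ∪ Near d Ψ (λ _ → 0ℤ)) Φ
    split [] [] = [] , [] , []
    split (φ ∷ Φ) (inj₁ φ∈ ∷ Φ⊆) with split Φ Φ⊆
    ... | Ψ , Ψ⊆ , Φ⊆′ = Ψ , Ψ⊆ , inj₁ φ∈ ∷ Φ⊆′
    split (φ ∷ Φ) (inj₂ φ∈ ∷ Φ⊆) with split Φ Φ⊆
    ... | Ψ , Ψ⊆ , Φ⊆′ = φ ∷ Ψ , φ∈ ∷ Ψ⊆ ,
      inj₂ (here (Poly-resp (λ v → identity (φ v)) Poly-0)) ∷
      All.map (λ { (inj₁ h) → inj₁ h ; (inj₂ h) → inj₂ (there h) }) Φ⊆′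
      where
      identity : ∀ x → 0ℤ ≡ x - (x - 0ℤ)
      identity = solve-∀

    near-invariant : ∀ {Ψ ω} → Invariant d (Θ ∪ Near d Ψ ω)
    near-invariant (inj₁ h) γ = inj₁ (inv h (Poly-suc γ))
    near-invariant {ω = ω} {φ} {γ} (inj₂ h) γ∈ = inj₂ (Any.map
      (λ {ψ} p → Poly-resp (λ v → identity (φ v) (γ v) (ψ v) (ω v)) (Poly-+ p γ∈)) h)
      where
      identity : ∀ a b c e → a - (c - e) + b ≡ a + b - (c - e)
      identity = solve-∀

    -- For φ in one of the classes, `shift u φ` differs from φ by a mixed difference, which lies in
    -- `Poly d` because φ lies in `Poly (suc d)`; so the class is kept.
    near-shiftClosed : ∀ {Ψ ω} → All (Poly (suc d)) Ψ → Poly (suc d) ω → ShiftClosed (Θ ∪ Near d Ψ ω)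
    near-shiftClosed Ψ⊆ ω∈ u (inj₁ h) = inj₁ (sh u h)
    near-shiftClosed {Ψ} {ω} Ψ⊆ ω∈ {φ} u (inj₂ h) = inj₂ (near Ψ⊆ h)
      where
      identity : ∀ x y a c e → (x - y - a) + (a - (c - e)) ≡ x - y - (c - e)
      identity = solve-∀
      identity′ : ∀ a b → a - b + b ≡ a
      identity′ = solve-∀
      derivative : Poly (suc d) φ → Poly d (λ v → shift u φ v - φ v)
      derivative (deriv p) = p u
      near : ∀ {Ψ} → All (Poly (suc d)) Ψ → Near d Ψ ω φ → Near d Ψ ω (shift u φ)
      near {ψ ∷ _} (ψ∈ ∷ _) (here p) = here (Poly-resp
        (λ v → identity (φ (u ∙ v)) (φ u) (φ v) (ψ v) (ω v))
        (Poly-+ (derivative (Poly-resp (λ v → identity′ (φ v) (ψ v - ω v))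
                       (Poly-+ (Poly-suc p) (Poly-- ψ∈ ω∈)))) p))
      near (_ ∷ Ψ⊆) (there h) = there (near Ψ⊆ h)

    -- The offset ω lets the induction run over the list of class representatives itself:
    -- subtracting ψ - ω from everything turns the offset ω into ψ.
    classes : ∀ Ψ ω → All (Poly (suc d)) Ψ → Poly (suc d) ω → GoodSet (Θ ∪ Near d Ψ ω)
    classes [] ω [] ω∈ Φ Φ⊆ = good Φ (All.map (λ { (inj₁ h) → h }) Φ⊆)
    classes (ψ ∷ Ψ) ω (ψ∈ ∷ Ψ⊆) ω∈ Φ Φ⊆ = focusing λ U →
      good-∪-Poly d near-invariant (near-shiftClosed Ψ⊆ ψ∈) (classes Ψ ψ Ψ⊆ ψ∈) (variants U Φ ψ′)
        (Allₚ.map⁺ (All.map subtract (Allₚ.++⁺ Φ⊆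
          (Allₚ.cartesianProductWith⁺ (setoid V) (setoid (V → ℤ)) shift U Φ
            λ {u} _ φ∈ → near-shiftClosed (ψ∈ ∷ Ψ⊆) ω∈ u (All.lookup Φ⊆ φ∈)))))
      where
      ψ′ : V → ℤ
      ψ′ v = ψ v - ω v
      identity : ∀ a b c e → a - (c - e) ≡ a - (b - e) - (c - b)
      identity = solve-∀
      subtract : ∀ {φ} → φ ∈ Θ ∪ Near d (ψ ∷ Ψ) ω →
                 (λ v → φ v - ψ′ v) ∈ (Θ ∪ Near d Ψ ψ) ∪ Poly d
      -- Θ absorbs the subtraction, the class of ψ falls into `Poly d`, and the other classes
      -- exchange the offset ω for ψ.
      subtract (inj₁ h) = inj₁ (inj₁ (inv h (Poly-neg (Poly-- ψ∈ ω∈))))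
      subtract (inj₂ (here p)) = inj₂ p
      subtract {φ} (inj₂ (there h)) = inj₁ (inj₂ (Any.map
        (λ {χ} → Poly-resp λ v → identity (φ v) (ψ v) (χ v) (ω v)) h))

  good-[] : Good []
  good-[] r l = let u , block = inhabited l in
    0ℤ ∷ [] , u ∷ [] , block ∷ [] , λ c → 0ℤ , u , here refl , here refl , []

  good-Poly : ∀ d → GoodSet (Poly d)
  good-Poly d Φ Φ⊆ = good-∪-Poly d {λ _ → ⊥} (λ ()) (λ _ ()) none Φ (All.map inj₂ Φ⊆)
    where
    none : GoodSet (λ _ → ⊥)
    none [] [] = good-[]
    none (_ ∷ _) (() ∷ _)

-- Polynomial van der Waerden along finite sums

linear : (ℕ⁺ → ℕ⁺) → List ℕ⁺ → ℤ
linear f v = + sum (map (val ∘ f) v)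

linear-additive : ∀ f → Polynomials.Additive _++_ (linear f)
linear-additive f u v = cong +_ (trans (cong sum (map-++ (val ∘ f) u v)) (sum-++ (map (val ∘ f) u) _))

Block : ℕ → List ℕ⁺ → Set
Block l v = 0 < length v × All (λ t → l < val t) v × Unique v

Block-inhabited : ∀ l → ∃ (Block l)
Block-inhabited l = pos (suc l) ∷ [] , s≤s z≤n , ℕₚ.≤-refl ∷ [] , [] ∷ []

Block-weaken : ∀ {l m v} → l ≤ m → Block m v → Block l v
Block-weaken l≤m (ne , v> , uniq) = ne , All.map (ℕₚ.≤-<-trans l≤m) v> , uniq

Block-++ : ∀ {l m u v} → l ≤ m → Block l u → sum (map val u) ≤ m → Block m v → Block l (u ++ v)
Block-++ {u = u} l≤m (ne , u> , u!) top≤m (_ , v> , v!) =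
  ℕₚ.<-≤-trans ne (ℕₚ.≤-trans (ℕₚ.m≤m+n _ _) (ℕₚ.≤-reflexive (sym (length-++ u)))) ,
  Allₚ.++⁺ u> (All.map (ℕₚ.≤-<-trans l≤m) v>) ,
  Unique-++⁺ u! v! λ (t∈u , t∈v) →
    ℕₚ.<-irrefl refl (ℕₚ.≤-<-trans (ℕₚ.≤-trans (∈⇒≤sum val t∈u) top≤m) (All.lookup v> t∈v))

toSet : ∀ {l} v → Block l v → Σ (𝒫f ℕ⁺) λ β → toList (elements β) ≡ v
toSet (t ∷ v) (_ , _ , uniq) = mk𝒫f (t List⁺.∷ v) uniq , refl

polynomial-van-der-Waerden : ∀ {r} (c : ℕ⁺ → Fin r) (F : List ℙ) (H : List (ℕ⁺ → ℕ⁺)) →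
  ∃[ n ] Σ (𝒫f ℕ⁺) λ β → ∀ {P f} → P ∈ₗ F → f ∈ₗ H →
    ∃[ n′ ] + val n′ ≡ + val n + eval P (+ (∑[ t ∈ β ] val (f t))) × c n′ ≡ c n
polynomial-van-der-Waerden {r} c F H = result
  where
  open Polynomials {List ℕ⁺} _++_
  -- The sum of a list bounds all its entries, so a block beyond that sum is disjoint from the list.
  open Colouring _++_ Block (sum ∘ map val) Block-inhabited Block-weaken Block-++
  Φ = cartesianProductWith (λ P f → eval P ∘ linear f) F H
  Φ-Poly : All (Poly (sum (map length F))) Φ
  Φ-Poly = Allₚ.cartesianProductWith⁺ (setoid _) (setoid _) _ F H λ {P} {f} P∈ _ →
    Poly-≤ (∈⇒≤sum length P∈) (Poly-eval (linear-additive f) P)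
  result : _
  result with good-Poly _ Φ Φ-Poly r 0
  ... | A , U , blocks , mono
    -- The window is fixed before any colouring, so `z` may enter the definition of the colouring of
    -- ℤ; at window points `toℕ⁺` never takes its default value.
    with positive-translate (window A U Φ)
  ... | z , positive
    with mono (λ i → c (toℕ⁺ (+ z + i)))
  ... | a , u , a∈ , u∈ , same
    with toSet u (All.lookup blocks u∈)
  ... | β , refl = toℕ⁺ (+ z + a) , β , λ {P} {f} P∈ f∈ →
    let φ∈ = ∈-cartesianProductWith⁺ (λ P f → eval P ∘ linear f) P∈ f∈ in
    toℕ⁺ (+ z + (a + eval P (linear f u))) ,
    trans (val-toℕ⁺ (positive (∈-window {Φ = Φ} {φ = eval P ∘ linear f} a∈ u∈ φ∈)))
          (trans (sym (ℤₚ.+-assoc (+ z) a _))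
                 (cong (λ i → i + eval P (linear f u)) (sym (val-toℕ⁺ (positive (∈-window₀ U Φ a∈)))))) ,
    All.lookup same φ∈

-- Minimal ultrafilters

≈-sym : ∀ {X} (p q : Ultrafilter X) → p ≈ q → q ≈ p
≈-sym p q p≈q A = mk⇔ (from (p≈q A)) (to (p≈q A))

≈-trans : ∀ {X} (p q r : Ultrafilter X) → p ≈ q → q ≈ r → p ≈ r
≈-trans p q r p≈q q≈r A = mk⇔ (to (q≈r A) ∘ to (p≈q A)) (from (p≈q A) ∘ from (q≈r A))

⊕-assoc : ∀ p q r → (p ⊕ q) ⊕ r ≈ p ⊕ (q ⊕ r)
⊕-assoc p q r A = mk⇔
  (upward p λ {x} → upward q λ {y} → upward r λ {z} → subst A (+⁺-assoc x y z))
  (upward p λ {x} → upward q λ {y} → upward r λ {z} → subst A (sym (+⁺-assoc x y z)))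

⊕-congˡ : ∀ p q r → q ≈ r → p ⊕ q ≈ p ⊕ r
⊕-congˡ p q r q≈r A = mk⇔ (upward p (to (q≈r _))) (upward p (from (q≈r _)))

-- A sum exceeds its first summand, so p ⊕ p contains the next tail as soon as p contains this one.
idempotent-∋-> : ∀ {p} → Idempotent p → ∀ l → p ∋ (λ n → l < val n)
idempotent-∋-> {p} idem zero    = upward p (λ {n} _ → 0<val n) (∋-U p)
idempotent-∋-> {p} idem (suc l) = to (idem _)
  (upward p (λ {m} l<m → upward p (λ {n} _ →
     ℕₚ.≤-trans (ℕₚ.≤-trans (s≤s l<m) (ℕₚ.≤-reflexive (ℕₚ.+-comm 1 (val m))))
       (ℕₚ.≤-trans (ℕₚ.+-monoʳ-≤ (val m) (0<val n)) (ℕₚ.≤-reflexive (sym (val-+⁺ m n)))))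
     (∋-U p))
   (idempotent-∋-> {p} idem l))

∋-All : ∀ {X I : Set} (p : Ultrafilter X) {Q : I → Pred X 0ℓ} {is} →
        All (λ i → p ∋ Q i) is → p ∋ (λ x → All (λ i → Q i x) is)
∋-All p []       = upward p (λ _ → []) (∋-U p)
∋-All p (h ∷ hs) = upward p (λ (a , as) → a ∷ as) (∋-∩ p h (∋-All p hs))

principalLeftIdeal : βℕ → Pred βℕ (lsuc 0ℓ)
principalLeftIdeal p q = ∃[ r ] q ≈ r ⊕ p

principal-LeftIdeal : ∀ p → LeftIdeal (principalLeftIdeal p)
principal-LeftIdeal p = record
  { respects = λ {q} {q′} q≈q′ (r , eq) → r , ≈-trans q′ q (r ⊕ p) (≈-sym q q′ q≈q′) eq
  ; nonempty = p ⊕ p , p , λ _ → mk⇔ id id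
  ; closed   = λ q {s} (r , eq) → q ⊕ r ,
      ≈-trans (q ⊕ s) (q ⊕ (r ⊕ p)) ((q ⊕ r) ⊕ p) (⊕-congˡ q s (r ⊕ p) eq)
              (≈-sym ((q ⊕ r) ⊕ p) (q ⊕ (r ⊕ p)) (⊕-assoc q r p))
  }

module Minimal (em : ExcludedMiddle 0ℓ) where

  ∋⇒∃ : ∀ {X} (p : Ultrafilter X) {A} → p ∋ A → ∃ A
  ∋⇒∃ p {A} h with em {∃ A}
  ... | yes x = x
  ... | no ∄  = ⊥-elim (∌-∅ p (upward p (λ {x} a → ∄ (x , a)) h))

  Hit : βℕ → Pred ℕ⁺ 0ℓ → ℕ → ℕ⁺ → Set
  Hit p A R n = ∃[ x ] val x ≤ R × (p ∋ λ y → (n +⁺ x) +⁺ y ∈ A)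

  -- The m with -m + A in p are the return times of a minimal point; unbounded gaps would give a
  -- left ideal inside `L` that misses p.
  syndetic : ∀ {p} → MinimalIdempotent p → ∀ {A} → p ∋ A → ∃[ R ] ∀ n → Hit p A R n
  syndetic {p} (idem , L , (L-ideal , L-minimal) , p∈L) {A} p∋A
    with em {∃[ R ] ∀ n → Hit p A R n}
  ... | yes h        = h
  ... | no ¬syndetic = ⊥-elim contra
    where
    gap : ∀ R → ∃[ n ] ¬ Hit p A R n
    gap R with em {∃[ n ] ¬ Hit p A R n}
    ... | yes n = n
    ... | no ∄  = ⊥-elim (¬syndetic (R , λ n → decidable-stable em λ ¬hit → ∄ (n , ¬hit)))

    -- A limit of starting points of ever longer gaps, so that A has no translate in q ⊕ p,
    -- although p lies in the left ideal generated by q ⊕ p.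
    q : βℕ
    q = image (proj₁ ∘ gap ∘ val) p

    p∈⟨q⊕p⟩ : p ∈ principalLeftIdeal (q ⊕ p)
    p∈⟨q⊕p⟩ = L-minimal _ (principal-LeftIdeal (q ⊕ p))
      (λ {s} (r , eq) → LeftIdeal.respects L-ideal (≈-sym s (r ⊕ (q ⊕ p)) eq)
        (LeftIdeal.closed L-ideal r (LeftIdeal.closed L-ideal q p∈L)))
      p∈L

    contra : ⊥
    contra with p∈⟨q⊕p⟩
    ... | r , p≈ with ∋⇒∃ r (to (p≈ A) p∋A)
    -- Members of p are unbounded, so some gap is longer than `x`, yet would be hit at distance `x`.
    ... | x , h with ∋⇒∃ p (∋-∩ p (idempotent-∋-> {p} idem (val x)) h)
    ... | R , x<R , h′ = proj₂ (gap (val R)) (x , ℕₚ.<⇒≤ x<R ,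
      upward p (λ {y} → subst A (trans (sym (+⁺-assoc x _ y)) (cong (_+⁺ y) (+⁺-comm x _)))) h′)

  -- Colour n by its distance x ≤ R to a translate of A in p. On a monochromatic configuration x is
  -- constant, and finitely many members of p share a point y; then n + x + y is the required a.
  minimal⇒𝒥p : ∀ {p} → MinimalIdempotent p → p ∈ 𝒥p
  minimal⇒𝒥p {p} min A p∋A F H with syndetic {p} min p∋A
  ... | R , step = result
    where
    c : ℕ⁺ → Fin (suc R)
    c n = fromℕ< (s≤s (proj₁ (proj₂ (step n))))
    c-≡ : ∀ {m n} → c m ≡ c n → proj₁ (step m) ≡ proj₁ (step n)
    c-≡ {m} {n} eq = val-injective (trans (sym (toℕ-fromℕ< _)) (trans (cong toℕ eq) (toℕ-fromℕ< _)))
    F′ = toList (elements F)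
    H′ = toList (elements H)
    result : _
    result with polynomial-van-der-Waerden c F′ H′
    ... | n , β , mono with ∋⇒∃ p (∋-All p {Q = λ (P , f) y →
             (+ val ((n +⁺ proj₁ (step n)) +⁺ y)) + eval P (+ (∑[ t ∈ β ] val (f t))) ∈ℤ A}
             {is = cartesianProduct F′ H′}
             (All.tabulate λ {(P , f)} Pf∈ → move P f (∈-cartesianProduct⁻ F′ H′ Pf∈)))
      where
      x = proj₁ (step n)
      move : ∀ P f → P ∈ₗ F′ × f ∈ₗ H′ → p ∋ λ y →
        (+ val ((n +⁺ x) +⁺ y)) + eval P (+ (∑[ t ∈ β ] val (f t))) ∈ℤ A
      move P f (P∈ , f∈) with mono P∈ f∈
      ... | n′ , eq , same = upward p (λ {y} a → (n′ +⁺ x) +⁺ y ,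
              subst (λ x → (n′ +⁺ x) +⁺ y ∈ A) (c-≡ same) a , (begin
          + val ((n′ +⁺ x) +⁺ y)             ≡⟨ +val-+⁺ n′ y ⟩
          + val n′ + (+ val x + + val y)     ≡⟨ cong (λ i → i + (+ val x + + val y)) eq ⟩
          + val n + e + (+ val x + + val y)  ≡⟨ swap (+ val n) e (+ val x + + val y) ⟩
          + val n + (+ val x + + val y) + e  ≡⟨ cong (λ i → i + e) (+val-+⁺ n y) ⟨
          + val ((n +⁺ x) +⁺ y) + e          ∎))
          (proj₂ (proj₂ (step n′)))
        where
        open ≡-Reasoning
        e = eval P (+ (∑[ t ∈ β ] val (f t)))
        swap : ∀ a b c → a + b + c ≡ a + c + b
        swap = solve-∀
        +val-+⁺ : ∀ n y → + val ((n +⁺ x) +⁺ y) ≡ + val n + (+ val x + + val y)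
        +val-+⁺ n y = cong +_ (trans (cong val (+⁺-assoc n x y))
          (trans (val-+⁺ n (x +⁺ y)) (cong (val n ℕ.+_) (val-+⁺ x y))))
    ... | y , hits = (n +⁺ proj₁ (step n)) +⁺ y , β , λ P f P∈ f∈ →
      All.lookup hits (∈-cartesianProduct⁺ P∈ f∈)

-- Finite sets

∈f⇒≤max : ∀ β {t} → t ∈f β → val t ≤ max β
∈f⇒≤max (mk𝒫f (s List⁺.∷ ss) _) = go s ss
  where
  go : ∀ s ss {t} → t ∈ₗ s ∷ ss → val t ≤ foldr₁ _⊔_ (List⁺.map val (s List⁺.∷ ss))
  go s []        (here refl) = ℕₚ.≤-refl
  go s (s′ ∷ ss) (here refl) = ℕₚ.m≤m⊔n _ _
  go s (s′ ∷ ss) (there t∈)  = ℕₚ.≤-trans (go s′ ss t∈) (ℕₚ.m≤n⊔m (val s) _)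

∈f⇒min≤ : ∀ β {t} → t ∈f β → min β ≤ val t
∈f⇒min≤ (mk𝒫f (s List⁺.∷ ss) _) = go s ss
  where
  go : ∀ s ss {t} → t ∈ₗ s ∷ ss → foldr₁ _⊓_ (List⁺.map val (s List⁺.∷ ss)) ≤ val t
  go s []        (here refl) = ℕₚ.≤-refl
  go s (s′ ∷ ss) (here refl) = ℕₚ.m⊓n≤m _ _
  go s (s′ ∷ ss) (there t∈)  = ℕₚ.≤-trans (ℕₚ.m⊓n≤n (val s) _) (go s′ ss t∈)

<min : ∀ β {l} → (∀ {t} → t ∈f β → l < val t) → l < min β
<min (mk𝒫f (s List⁺.∷ ss) _) {l} = go s ss
  where
  go : ∀ s ss → (∀ {t} → t ∈ₗ s ∷ ss → l < val t) → l < foldr₁ _⊓_ (List⁺.map val (s List⁺.∷ ss))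
  go s []        l< = l< (here refl)
  go s (s′ ∷ ss) l< = ℕₚ.⊓-glb (l< (here refl)) (go s′ ss (l< ∘ there))

≋-sym : ∀ {X} (G K : 𝒫f X) → G ≋ K → K ≋ G
≋-sym G K (G⊆K , K⊆G) = (λ {x} → K⊆G {x}) , (λ {x} → G⊆K {x})

≋-trans : ∀ {X} (G K L : 𝒫f X) → G ≋ K → K ≋ L → G ≋ L
≋-trans G K L (G⊆K , K⊆G) (K⊆L , L⊆K) =
  (λ {x} x∈ → K⊆L {x} (G⊆K {x} x∈)) , (λ {x} x∈ → K⊆G {x} (L⊆K {x} x∈))

-- Taylor increments

infixl 6 _+ᴾ_
_+ᴾ_ : ℙ → ℙ → ℙ
[]       +ᴾ Q        = Q
(c ∷ cs) +ᴾ []       = c ∷ cs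
(c ∷ cs) +ᴾ (e ∷ es) = (c + e) ∷ (cs +ᴾ es)

eval-+ᴾ : ∀ P Q x → eval (P +ᴾ Q) x ≡ eval P x + eval Q x
eval-+ᴾ []       Q        x = sym (ℤₚ.+-identityˡ _)
eval-+ᴾ (c ∷ cs) []       x = sym (ℤₚ.+-identityʳ _)
eval-+ᴾ (c ∷ cs) (e ∷ es) x =
  trans (cong (λ y → x * (c + e + y)) (eval-+ᴾ cs es x)) (identity x c e _ _)
  where
  identity : ∀ x c e p q → x * (c + e + (p + q)) ≡ x * (c + p) + x * (e + q)
  identity = solve-∀

eval-map-* : ∀ k P x → eval (map (k *_) P) x ≡ k * eval P x
eval-map-* k []       x = sym (ℤₚ.*-zeroʳ k)
eval-map-* k (c ∷ cs) x =
  trans (cong (λ y → x * (k * c + y)) (eval-map-* k cs x)) (identity k x c _)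
  where
  identity : ∀ k x c p → x * (k * c + k * p) ≡ k * (x * (c + p))
  identity = solve-∀

-- The Taylor increment Q(x) = P(s + x) - P(s), again without constant term, computed along the
-- Horner form of P.
increment : ℤ → ℙ → ℙ
increment s []       = []
increment s (c ∷ cs) = (c + eval cs s ∷ increment s cs) +ᴾ map (s *_) (increment s cs)

eval-increment : ∀ s P x → eval (increment s P) x ≡ eval P (s + x) - eval P s
eval-increment s []       x = refl
eval-increment s (c ∷ cs) x = begin
  eval ((c + eval cs s ∷ Q) +ᴾ map (s *_) Q) x
    ≡⟨ eval-+ᴾ (c + eval cs s ∷ Q) (map (s *_) Q) x ⟩
  x * (c + eval cs s + eval Q x) + eval (map (s *_) Q) x
    ≡⟨ cong (λ y → x * (c + eval cs s + eval Q x) + y) (eval-map-* s Q x) ⟩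
  x * (c + eval cs s + eval Q x) + s * eval Q x
    ≡⟨ cong (λ y → x * (c + eval cs s + y) + s * y) (eval-increment s cs x) ⟩
  x * (c + eval cs s + (eval cs (s + x) - eval cs s)) + s * (eval cs (s + x) - eval cs s)
    ≡⟨ identity s x c (eval cs s) (eval cs (s + x)) ⟩
  (s + x) * (c + eval cs (s + x)) - s * (c + eval cs s) ∎
  where
  open ≡-Reasoning
  Q = increment s cs
  identity : ∀ s x c p q →
    x * (c + p + (q - p)) + s * (q - p) ≡ (s + x) * (c + q) - s * (c + p)
  identity = solve-∀

eval-0 : ∀ P → eval P 0ℤ ≡ 0ℤ
eval-0 []       = refl
eval-0 (c ∷ cs) = ℤₚ.*-zeroˡ (c + eval cs 0ℤ)

-- The construction of α and H

-- The J_p-property in the form used below: lists may be empty or repeat entries, and β lies beyond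
-- a given `l`, which will separate the values of H.
JpList : Pred ℕ⁺ 0ℓ → Set
JpList A = (F : List ℙ) (H : List (ℕ⁺ → ℕ⁺)) (l : ℕ) → ∃[ a ] Σ (𝒫f ℕ⁺) λ β → l < min β ×
  (∀ {P f} → P ∈ₗ F → f ∈ₗ H → (+ val a) + eval P (+ (∑[ t ∈ β ] val (f t))) ∈ℤ A)

-- Sizes and canonical representatives of finite sets

module Sets (em : ExcludedMiddle 0ℓ) where

  ⊊f⇒length< : ∀ {X} (G K : 𝒫f X) → G ⊊f K →
               length (toList (elements G)) < length (toList (elements K))
  ⊊f⇒length< G K (G⊆K , K⊈G) =
    ℕₚ.≤∧≢⇒< (Unique-⊆-length (unique G) G⊆K) λ eq → K⊈G (onto eq)
    where
    onto : length (toList (elements G)) ≡ length (toList (elements K)) → K ⊆f G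
    onto eq {x} x∈K with em {x ∈f G}
    ... | yes x∈G = x∈G
    ... | no  x∉G = ⊥-elim (ℕₚ.<-irrefl eq (Unique-⊆-length (Allₚ.¬Any⇒All¬ _ x∉G ∷ unique G)
            λ { (here refl) → x∈K ; (there y∈) → G⊆K y∈ }))

  -- The extra element keeps the set nonempty when the list is empty.
  enclose : ∀ {X : Set} → X → (xs : List X) → Σ (𝒫f X) λ G → ∀ {y} → y ∈ₗ xs → y ∈f G
  enclose x xs = mk𝒫f (_ List⁺.∷ _) (deduplicate-! (λ _ _ → em) (x ∷ xs)) ,
    λ y∈ → ∈-deduplicate⁺ (λ _ _ → em) {x ∷ xs} (there y∈)

  module _ {X : Set} (ext : Extensionality 0ℓ 0ℓ) where

    -- The equivalence class of G under `_≋_`; by extensionality, equivalent enumerations give the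
    -- same function, on which a choice can depend.
    indicator : 𝒫f X → 𝒫f X → Bool
    indicator G K = does (em {G ≋ K})

    indicator-cong : ∀ {G K} → G ≋ K → indicator G ≡ indicator K
    indicator-cong {G} {K} G≋K = ext λ L → does-⇔
      (mk⇔ (≋-trans K G L (≋-sym G K G≋K)) (≋-trans G K L G≋K))
      (em {G ≋ L}) (em {K ≋ L})

    -- Recomputation discards its irrelevant argument, so the choice depends on χ alone.
    choose : ∀ χ → .(∃[ G ] indicator G ≡ χ) → ∃[ G ] indicator G ≡ χ
    choose χ = recompute em

    representative : 𝒫f X → 𝒫f X
    representative G = proj₁ (choose (indicator G) (G , refl))

    representative-cong : ∀ {G K} → G ≋ K → representative G ≡ representative K
    representative-cong {G} {K} G≋K = lemma (indicator-cong {G} {K} G≋K) (G , refl) (K , refl)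
      where
      lemma : ∀ {χ χ′} → χ ≡ χ′ → ∀ e e′ → proj₁ (choose χ e) ≡ proj₁ (choose χ′ e′)
      lemma refl e e′ = refl

    representative-≋ : ∀ G → representative G ≋ G
    representative-≋ G = witness em
      (trans (cong (λ χ → χ G) (proj₂ (choose (indicator G) (G , refl))))
             (dec-true em ((λ {x} x∈ → x∈) , (λ {x} x∈ → x∈))))
      where
      witness : ∀ {P : Set} (P? : Dec P) → does P? ≡ true → P
      witness (yes p) _ = p

  -- Translating the arguments of all functions by suc l moves β beyond l.
  JpSet⇒JpList : ∀ {A} → JpSet A → JpList A
  JpSet⇒JpList {A} jp F H l with enclose [] F | enclose id (map (λ f t → f (pos (suc l) +⁺ t)) H)
  ... | F′ , F⊆ | H′ , H⊆ with jp F′ H′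
  ... | a , mk𝒫f (t List⁺.∷ ts) uniq , hits = a , β , <min β beyond , λ {P} {f} P∈ f∈ →
    subst (λ s → (+ val a) + eval P (+ s) ∈ℤ A)
          (cong sum (map-∘ {g = val ∘ f} {f = later} (t ∷ ts)))
          (hits P (f ∘ later) (F⊆ P∈) (H⊆ (∈-map⁺ (λ f t → f (later t)) f∈)))
    where
    later : ℕ⁺ → ℕ⁺
    later t = pos (suc l) +⁺ t
    later-injective : ∀ {s t} → later s ≡ later t → s ≡ t
    later-injective eq = val-injective (ℕₚ.+-cancelˡ-≡ (suc l) _ _ (cong val eq))
    β : 𝒫f ℕ⁺
    β = mk𝒫f (later t List⁺.∷ map later ts) (Unique-map⁺ later-injective uniq)
    beyond : ∀ {s} → s ∈ₗ map later (t ∷ ts) → l < val s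
    beyond s∈ with ∈-map⁻ later {xs = t ∷ ts} s∈
    ... | t , _ , refl = s≤s (ℕₚ.m≤m+n l (val t))

-- Last entry first, so that `_∷ʳ_`, by which `⨂` grows, becomes `_∷_`.
reversed : ∀ {n} → (Fin n → ℤ) → List ℤ
reversed {zero}  z = []
reversed {suc n} z = z (fromℕ n) ∷ reversed (z ∘ inject₁)

reversed-injective : ∀ {n} {y z : Fin n → ℤ} → reversed y ≡ reversed z → ∀ j → y j ≡ z j
reversed-injective {suc n} eq j with ∷-injective eq | view j
... | last , _    | ‵fromℕ     = last
... | _    , rest | ‵inject₁ i = reversed-injective rest i

entries : ∀ {n} → Vec ℕ⁺ n → Fin n → ℤ
entries x j = + val (Vec.lookup x j)

reversed-cong : ∀ {n} {y z : Fin n → ℤ} → (∀ j → y j ≡ z j) → reversed y ≡ reversed z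
reversed-cong {zero}  eq = refl
reversed-cong {suc n} eq = cong₂ _∷_ (eq (fromℕ n)) (reversed-cong (eq ∘ inject₁))

reversed-∷ʳ : ∀ {n} (x : Vec ℕ⁺ n) y →
  reversed (entries (x ∷ʳ y)) ≡ + val y ∷ reversed (entries x)
reversed-∷ʳ x y = cong₂ _∷_ (cong (λ n → + val n) (last x)) (reversed-cong λ j → cong (λ n → + val n) (init x j))
  where
  last : ∀ {n} (x : Vec ℕ⁺ n) → Vec.lookup (x ∷ʳ y) (fromℕ n) ≡ y
  last Vec.[]      = refl
  last (_ Vec.∷ x) = last x
  init : ∀ {n} (x : Vec ℕ⁺ n) j → Vec.lookup (x ∷ʳ y) (inject₁ j) ≡ Vec.lookup x j
  init (_ Vec.∷ x) zero    = refl
  init (_ Vec.∷ x) (suc j) = init x j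

-- Starred points

star : βℕ → Pred ℕ⁺ 0ℓ → Pred ℕ⁺ 0ℓ
star p A y = A y × (p ∋ λ z → A (y +⁺ z))

module _ {p : βℕ} (idem : Idempotent p) where

  ∋-star : ∀ {A} → p ∋ A → p ∋ star p A
  ∋-star p∋A = ∋-∩ p p∋A (from (idem _) p∋A)

  -- Since -y + A is in p, so is its star, and y + z is starred for A whenever z is starred for -y +
  -- A.
  star-+⁺ : ∀ {A y} → y ∈ star p A → p ∋ λ z → y +⁺ z ∈ star p A
  star-+⁺ {A} {y} (_ , h) = upward p
    (λ {z} (a , b) → a , upward p (λ {w} → subst A (sym (+⁺-assoc y z w))) b)
    (∋-star h)

tuples : ∀ {X : Set} → List X → ℕ → List (List X)
tuples xs zero    = [] ∷ []
tuples xs (suc n) = cartesianProductWith _∷_ xs (tuples xs n)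

∈-tuples : ∀ {X : Set} {xs : List X} ys → ys ⊆ₗ xs → ys ∈ₗ tuples xs (length ys)
∈-tuples []       _     = here refl
∈-tuples (y ∷ ys) ys⊆xs =
  ∈-cartesianProductWith⁺ _∷_ (ys⊆xs (here refl)) (∈-tuples ys (ys⊆xs ∘ there))

module Construction {k : ℕ} {p : βℕ} (idem : Idempotent p) (large : ∀ {A} → p ∋ A → JpList A)
  {A : Pred (Vec ℕ⁺ (suc k)) 0ℓ} (p⨂∋A : ⨂ k (λ _ → p) ∋ A) (T : List ℙ) where

  -- Sections xs: the entries chosen so far, the last one first, with d entries to follow.
  Prefix : ℕ → List ℤ → Set
  Prefix zero    xs = ∃[ x ] x ∈ A × reversed (entries x) ≡ xs
  Prefix (suc d) xs = p ∋ λ y → Prefix d (+ val y ∷ xs)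

  -- suc (n + d), in the form in which ⨂ and available-sets count down.
  total : ℕ → ℕ → ℕ
  total zero    d = suc d
  total (suc n) d = total n (suc d)

  ⨂⇒Prefix : ∀ n {d} → ⨂ n (λ _ → p) ∋ (λ x → Prefix d (reversed (entries x))) → Prefix (total n d) []
  ⨂⇒Prefix zero    h = h
  ⨂⇒Prefix (suc n) {d} h = ⨂⇒Prefix n (upward (⨂ n (λ _ → p))
    (λ {x} → upward p λ {y} → subst (Prefix d) (reversed-∷ʳ x y)) h)

  Prefix-[] : Prefix (total k 0) []
  Prefix-[] = ⨂⇒Prefix k (upward (⨂ k (λ _ → p)) (λ {x} a → x , a , refl) p⨂∋A)

  -- In busy d xs P s y the current entry y is the sum of the shifts used so far plus P s.
  data State : Set where
    done : (xs : List ℤ) → State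
    busy : (d : ℕ) (xs : List ℤ) (P : ℙ) (s : ℕ) (y : ℤ) → State

  -- Lying in the section lets the current entry be closed; the star lets it grow further.
  Candidates : ℕ → List ℤ → Pred ℕ⁺ 0ℓ
  Candidates d xs = star p (λ y → Prefix d (+ val y ∷ xs))

  Extends : State → Pred ℕ⁺ 0ℓ
  Extends (done xs)         z = ⊤
  Extends (busy d xs P s y) z = y + + val z ∈ℤ Candidates d xs

  Sound : Pred State 0ℓ
  Sound (done xs)           = Prefix 0 xs
  Sound σ@(busy _ _ _ _ _)  = p ∋ Extends σ

  Sound⇒∋ : ∀ σ → Sound σ → p ∋ Extends σ
  Sound⇒∋ (done xs)         _ = upward p (λ _ → tt) (∋-U p)
  Sound⇒∋ (busy d xs P s y) h = h

  starts : ℕ → List ℤ → List State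
  starts zero    xs = done xs ∷ []
  starts (suc d) xs = map (λ P → busy d xs P 0 0ℤ) T

  starts-sound : ∀ d {xs} → Prefix d xs → All Sound (starts d xs)
  starts-sound zero    h = h ∷ []
  starts-sound (suc d) {xs} h = Allₚ.map⁺ (All.universal
    (λ P → upward p (λ {z} c → z , c , sym (ℤₚ.+-identityˡ _)) (∋-star {p} idem {λ y → Prefix d (+ val y ∷ xs)} h)) T)

  increments : State → ℙ
  increments (done xs)         = []
  increments (busy d xs P s y) = increment (+ s) P

  -- After an increment the entry may continue or be closed with the next one starting; both
  -- outcomes are kept.
  successors : ℕ⁺ → ℕ → State → List State
  successors a x (done xs)           = []
  successors a x σ@(busy d xs P s y) =
    busy d xs P (s ℕ.+ x) y′ ∷ starts d (y′ ∷ xs)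
    where y′ = y + (+ val a + eval (increments σ) (+ x))

  successors-sound : ∀ {a x} σ → (+ val a) + eval (increments σ) (+ x) ∈ℤ Extends σ →
                     All Sound (successors a x σ)
  successors-sound (done xs)         _ = []
  successors-sound {a} {x} (busy d xs P s y) (n , (m , m∈ , m≡) , n≡) =
    upward p (λ {z} c → m +⁺ z , c , trans (cong +_ (val-+⁺ m z)) (cong (λ i → i + + val z) m≡y′))
             (star-+⁺ {p} idem {λ y → Prefix d (+ val y ∷ xs)} {m} m∈)
    ∷ starts-sound d (subst (λ i → Prefix d (i ∷ xs)) m≡y′ (proj₁ m∈))
    where
    m≡y′ : + val m ≡ y + (+ val a + eval (increment (+ s) P) (+ x))
    m≡y′ = trans m≡ (cong (λ i → y + i) n≡)

  -- What smaller sets leave behind: a bound for the blocks used and the partially built tuples.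
  record Pool : Set where
    field
      bound  : ℕ
      states : List State
      sound  : All Sound states
  open Pool

  infix 4 _≼_
  record _≼_ (Q R : Pool) : Set where
    constructor _,_
    field
      bound≤  : bound Q ≤ bound R
      states⊆ : states Q ⊆ₗ states R
  open _≼_

  ≼-refl : ∀ {Q} → Q ≼ Q
  ≼-refl = ℕₚ.≤-refl , id

  ≼-trans : ∀ {Q R S} → Q ≼ R → R ≼ S → Q ≼ S
  ≼-trans (b , s) (b′ , s′) = ℕₚ.≤-trans b b′ , s′ ∘ s

  merge : List Pool → Pool
  merge Qs = record
    { bound  = sum (map bound Qs)
    ; states = concat (map states Qs)
    ; sound  = Allₚ.concat⁺ (Allₚ.map⁺ (All.universal sound Qs))
    }

  ≼-merge : ∀ {Q} Qs → Q ∈ₗ Qs → Q ≼ merge Qs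
  ≼-merge Qs Q∈ = ∈⇒≤sum bound Q∈ , λ σ∈ → ∈-concat⁺′ σ∈ (∈-map⁺ states Q∈)

  initial : Pool
  initial = record
    { bound = 0 ; states = starts (total k 0) [] ; sound = starts-sound (total k 0) Prefix-[] }

  -- The demands of all states intersect in a member of p, so one shift and one block serve every
  -- state and every function.
  extension : (G : List (ℕ⁺ → ℕ⁺)) (Q : Pool) → ∃[ a ] Σ (𝒫f ℕ⁺) λ β → bound Q < min β ×
    (∀ {P f} → P ∈ₗ map increments (states Q) → f ∈ₗ G →
       (+ val a) + eval P (+ (∑[ t ∈ β ] val (f t))) ∈ℤ λ z → All (λ σ → Extends σ z) (states Q))
  extension G Q = large (∋-All p (All.map (λ {σ} → Sound⇒∋ σ) (sound Q))) _ G (bound Q)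

  shiftOf : List (ℕ⁺ → ℕ⁺) → Pool → ℕ⁺
  shiftOf G Q = proj₁ (extension G Q)

  blockOf : List (ℕ⁺ → ℕ⁺) → Pool → 𝒫f ℕ⁺
  blockOf G Q = proj₁ (proj₂ (extension G Q))

  sumOf : List (ℕ⁺ → ℕ⁺) → Pool → (ℕ⁺ → ℕ⁺) → ℕ
  sumOf G Q f = ∑[ t ∈ blockOf G Q ] val (f t)

  advance : List (ℕ⁺ → ℕ⁺) → Pool → Pool
  advance G Q = record
    { bound  = max (blockOf G Q)
    ; states = concat (cartesianProductWith step (states Q) G)
    ; sound  = Allₚ.concat⁺ (Allₚ.cartesianProductWith⁺ (setoid _) (setoid _) step (states Q) G
        λ {σ} {f} σ∈ f∈ →
          let n , all , eq = proj₂ (proj₂ (proj₂ (extension G Q))) (∈-map⁺ increments σ∈) f∈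
          in successors-sound σ (n , All.lookup all σ∈ , eq))
    }
    where
    step : State → (ℕ⁺ → ℕ⁺) → List State
    step σ f = successors (shiftOf G Q) (sumOf G Q f) σ

  ∈-advance : ∀ {G Q σ f τ} → σ ∈ₗ states Q → f ∈ₗ G →
    τ ∈ₗ successors (shiftOf G Q) (sumOf G Q f) σ → τ ∈ₗ states (advance G Q)
  ∈-advance σ∈ f∈ τ∈ = ∈-concat⁺′ τ∈ (∈-cartesianProductWith⁺ _ σ∈ f∈)

  -- Lists over F of length less than n, in place of the proper subsets of F: all chains of finite
  -- sets are covered, and the recursion is structural in n.
  poolBelow : ℕ → List (ℕ⁺ → ℕ⁺) → Pool
  parts     : ℕ → List (ℕ⁺ → ℕ⁺) → List Pool
  poolBelow zero    F = initial
  poolBelow (suc n) F = merge (parts n F)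
  parts n F = poolBelow n F ∷ map (λ G → advance G (poolBelow n G)) (tuples F n)

  pool : List (ℕ⁺ → ℕ⁺) → Pool
  pool F = poolBelow (length F) F

  initial≼poolBelow : ∀ n F → initial ≼ poolBelow n F
  initial≼poolBelow zero    F = ≼-refl
  initial≼poolBelow (suc n) F =
    ≼-trans (initial≼poolBelow n F) (≼-merge (parts n F) (here refl))

  -- As a tuple over `F`, the list `G` enters at stage `suc (length G)`, and each later stage
  -- contains the one before.
  advance≼pool : ∀ {G F} → G ⊆ₗ F → length G < length F → advance G (pool G) ≼ pool F
  advance≼pool {G} {F} G⊆F = go (length F)
    where
    go : ∀ n → length G < n → advance G (pool G) ≼ poolBelow n F
    go (suc n) (s≤s |G|≤n) with ℕₚ.m≤n⇒m<n∨m≡n |G|≤n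
    ... | inj₁ |G|<n = ≼-trans (go n |G|<n) (≼-merge (parts n F) (here refl))
    ... | inj₂ refl  = ≼-merge (parts n F) (there (∈-map⁺ (λ G → advance G (poolBelow n G)) (∈-tuples G G⊆F)))

  α₀ : List (ℕ⁺ → ℕ⁺) → ℕ⁺
  α₀ F = shiftOf F (pool F)

  H₀ : List (ℕ⁺ → ℕ⁺) → 𝒫f ℕ⁺
  H₀ F = blockOf F (pool F)

  -- The bound of `advance G (pool G)` is the maximum of `H₀ G`, and `H₀ F` is chosen beyond the
  -- bound of `pool F`.
  H₀-increasing : ∀ {G F} → G ⊆ₗ F → length G < length F → H₀ G <f H₀ F
  H₀-increasing {G} {F} G⊆F |G|<|F| = ℕₚ.≤-<-trans (bound≤ (advance≼pool G⊆F |G|<|F|))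
    (proj₁ (proj₂ (proj₂ (extension F (pool F)))))

  sound-pool : ∀ {F σ} → σ ∈ₗ states (pool F) → Sound σ
  sound-pool {F} = All.lookup (sound (pool F))

  -- Building the tuple along a chain

  module Walk (E : ℕ⁺ → List (ℕ⁺ → ℕ⁺))
    (E-⊆ : ∀ {i j} → val i < val j → E i ⊆ₗ E j)
    (E-< : ∀ {i j} → val i < val j → length (E i) < length (E j))
    (f : ℕ⁺ → ℕ⁺ → ℕ⁺) (f∈E : ∀ i → f i ∈ₗ E i) where

    α : ℕ⁺ → ℕ
    α i = val (α₀ (E i))

    S : ℕ⁺ → ℕ
    S i = ∑[ t ∈ H₀ (E i) ] val (f i t)

    -- A state reached with indices up to `l` waits in the pool of every later member of the chain.
    Available : ℕ → Pred State 0ℓ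
    Available l σ = ∀ i → l < val i → σ ∈ₗ states (pool (E i))

    available-≤ : ∀ {l m σ} → l ≤ m → Available l σ → Available m σ
    available-≤ l≤m av i m< = av i (ℕₚ.≤-<-trans l≤m m<)

    available-initial : ∀ {σ} → σ ∈ₗ starts (total k 0) [] → Available 0 σ
    available-initial σ∈ i _ = states⊆ (initial≼poolBelow (length (E i)) (E i)) σ∈

    available-successors : ∀ {l σ τ i} → Available l σ → l < val i →
      τ ∈ₗ successors (α₀ (E i)) (S i) σ → Available (val i) τ
    available-successors {i = i} av l<i τ∈ j i<j =
      states⊆ (advance≼pool (E-⊆ i<j) (E-< i<j)) (∈-advance {G = E i} {Q = pool (E i)} (av i l<i) (f∈E i) τ∈)

    value : ℙ → ℕ → ℕ → ℤ
    value P a s = + a + eval P (+ s)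

    -- The Taylor increments telescope, so the current entry keeps the form `value P a s`.
    available-step : ∀ {l d xs P a s i} → Available l (busy d xs P s (value P a s)) → l < val i →
      let v = value P (a ℕ.+ α i) (s ℕ.+ S i) in
      ∀ {τ} → τ ∈ₗ busy d xs P (s ℕ.+ S i) v ∷ starts d (v ∷ xs) → Available (val i) τ
    available-step {l} {d} {xs} {P} {a} {s} {i} av l<i τ∈ =
      available-successors av l<i
        (subst (λ y → _ ∈ₗ busy d xs P (s ℕ.+ S i) y ∷ starts d (y ∷ xs)) (sym value≡) τ∈)
      where
      identity : ∀ a b p q → a + p + (b + (q - p)) ≡ a + b + q
      identity = solve-∀
      value≡ : value P a s + (+ α i + eval (increment (+ s) P) (+ S i)) ≡ value P (a ℕ.+ α i) (s ℕ.+ S i)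
      value≡ = trans (cong (λ y → value P a s + (+ α i + y)) (eval-increment (+ s) P (+ S i)))
                     (identity (+ a) (+ α i) (eval P (+ s)) (eval P (+ (s ℕ.+ S i))))

    -- Each index but the last continues the current entry; the last one closes it.
    available-block : ∀ {l m d xs P a s} i is → AllPairs (λ i j → val i < val j) (i ∷ is) →
      l < val i → All (λ j → val j ≤ m) (i ∷ is) →
      Available l (busy d xs P s (value P a s)) →
      ∀ {τ} → τ ∈ₗ starts d (value P (a ℕ.+ sum (map α (i ∷ is))) (s ℕ.+ sum (map S (i ∷ is))) ∷ xs) →
      Available m τ
    available-block {d = d} {xs} {P} {a} {s} i [] _ l<i (i≤m ∷ []) av τ∈ =
      available-≤ i≤m (available-step {P = P} {a} {s} av l<i
        (there (subst (λ v → _ ∈ₗ starts d (v ∷ xs))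
          (cong₂ (λ x y → value P (a ℕ.+ x) (s ℕ.+ y)) (ℕₚ.+-identityʳ (α i)) (ℕₚ.+-identityʳ (S i))) τ∈)))
    available-block {d = d} {xs} {P} {a} {s} i (j ∷ js) ((i<j ∷ _) ∷ sorted) l<i (_ ∷ ≤m) av τ∈ =
      available-block {P = P} {a ℕ.+ α i} {s ℕ.+ S i} j js sorted i<j ≤m
        (available-step {P = P} {a} {s} av l<i (here refl))
        (subst (λ v → _ ∈ₗ starts d (v ∷ xs))
          (cong₂ (value P) (sym (ℕₚ.+-assoc a (α i) _)) (sym (ℕₚ.+-assoc s (S i) _))) τ∈)

    open Data.List.Sort (On.decTotalOrder ℕₚ.≤-decTotalOrder val) using (sort; sort-↭; sort-↗)

    sort-increasing : (β : 𝒫f ℕ⁺) → AllPairs (λ i j → val i < val j) (sort (toList (elements β)))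
    sort-increasing β = AllPairs.zipWith (λ (i≤j , i≢j) → ℕₚ.≤∧≢⇒< i≤j (i≢j ∘ val-injective))
      (Sorted⇒AllPairs (On.totalOrder ℕₚ.≤-totalOrder val) (sort-↗ _) ,
       Unique-resp-↭ (setoid ℕ⁺) (↭⇒↭ₛ (↭-sym (sort-↭ _))) (unique β))

    -- The chain is climbed in increasing order, so the enumeration of β is sorted first; the sums
    -- do not change.
    available-set : ∀ {l d xs P} (β : 𝒫f ℕ⁺) → l < min β → P ∈ₗ T →
      (∀ {σ} → σ ∈ₗ starts (suc d) xs → Available l σ) →
      ∀ {τ} → τ ∈ₗ starts d (value P (∑ β α) (∑ β S) ∷ xs) → Available (max β) τ
    available-set {l} {d} {xs} {P} β l<β P∈ av = go (sort (toList (elements β))) (sort-↭ _) (sort-increasing β)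
      where
      go : ∀ is → is ↭ toList (elements β) → AllPairs (λ i j → val i < val j) is →
        ∀ {τ} → τ ∈ₗ starts d (value P (∑ β α) (∑ β S) ∷ xs) → Available (max β) τ
      go [] perm _ with () ← ∈-resp-↭ (↭-sym perm) (here refl)
      go (i ∷ is) perm sorted τ∈ = available-block {P = P} {0} {0} i is sorted
        (ℕₚ.<-≤-trans l<β (∈f⇒min≤ β (∈-resp-↭ perm (here refl))))
        (All.tabulate λ j∈ → ∈f⇒≤max β (∈-resp-↭ perm j∈))
        (subst (λ y → Available l (busy d xs P 0 y)) (sym (trans (ℤₚ.+-identityˡ _) (eval-0 P)))
          (av (∈-map⁺ (λ P → busy d xs P 0 0ℤ) P∈)))
        (subst (λ v → _ ∈ₗ starts d (v ∷ xs))
          (cong₂ (value P) (sym (sum-↭ (↭-map⁺ α perm))) (sym (sum-↭ (↭-map⁺ S perm)))) τ∈)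

    available-sets : ∀ n {d} (β : Fin (suc n) → 𝒫f ℕ⁺) → (∀ j → β (inject₁ j) <f β (suc j)) →
      (P : Fin (suc n) → ℙ) → (∀ j → P j ∈ₗ T) →
      (∀ {σ} → σ ∈ₗ starts (total n d) [] → Available 0 σ) →
      ∀ {τ} → τ ∈ₗ starts d (reversed (λ j → value (P j) (∑ (β j) α) (∑ (β j) S))) →
      Available (max (β (fromℕ n))) τ
    available-sets zero β β< P P∈ av =
      available-set (β zero) (<min (β zero) (λ {t} _ → 0<val t)) (P∈ zero) av
    available-sets (suc n) β β< P P∈ av =
      available-set (β (suc (fromℕ n))) (β< (fromℕ n)) (P∈ (suc (fromℕ n)))
        (available-sets n (β ∘ inject₁) (β< ∘ inject₁) (P ∘ inject₁) (P∈ ∘ inject₁) av)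

    walk : (β : Fin (suc k) → 𝒫f ℕ⁺) → (∀ j → β (inject₁ j) <f β (suc j)) →
      (P : Fin (suc k) → ℙ) → (∀ j → P j ∈ₗ T) →
      (λ j → value (P j) (∑ (β j) α) (∑ (β j) S)) ∈ℤ^ A
    walk β β< P P∈
      -- Any index beyond the last block would do: its pool holds the `done` state of the full
      -- tuple, whose soundness is membership in A.
      with x , x∈A , eq ← sound-pool {E (pos (suc (max (β (fromℕ k)))))}
        (available-sets k β β< P P∈ available-initial (here refl) _ ℕₚ.≤-refl)
      = x , x∈A , reversed-injective eq

-- Strict chains and the theorem

⊊f-trans : ∀ {X} (G K L : 𝒫f X) → G ⊊f K → K ⊊f L → G ⊊f L
⊊f-trans G K L (G⊆K , K⊈G) (K⊆L , _) =
  (λ {x} x∈ → K⊆L {x} (G⊆K {x} x∈)) , λ L⊆G → K⊈G λ {x} x∈ → L⊆G {x} (K⊆L {x} x∈)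

⊊f-chain : ∀ {X} (G : ℕ⁺ → 𝒫f X) → (∀ i → G i ⊊f G (suc⁺ i)) →
  ∀ {i j} → val i < val j → G i ⊊f G j
⊊f-chain {X} G step {i} {pos (suc n)} (s≤s i≤n) = go n i≤n
  where
  go : ∀ n → val i ≤ n → G i ⊊f G (pos (suc n))
  go zero i≤0 = ⊥-elim (ℕₚ.<-irrefl refl (ℕₚ.<-≤-trans (0<val i) i≤0))
  go (suc n) i≤1+n with ℕₚ.m≤n⇒m<n∨m≡n i≤1+n
  ... | inj₁ (s≤s i≤n) = ⊊f-trans (G i) (G (pos (suc n))) (G (pos (suc (suc n)))) (go n i≤n) (step (pos (suc n)))
  ... | inj₂ i≡1+n = subst (λ i → G i ⊊f G (pos (suc (suc n)))) (sym (val-injective i≡1+n)) (step (pos (suc n)))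

corollary1p28 : (∀ {ℓ} → ExcludedMiddle ℓ) →
    (∀ {a b} → Extensionality a b) →
    (k : ℕ) (p : βℕ) →
    MinimalIdempotent p ⊎ (Idempotent p × p ∈ 𝒥p) →
    (A : Pred (Vec ℕ⁺ (suc k)) 0ℓ) → ⨂ k (λ _ → p) ∋ A →
    (T : 𝒫f ℙ) →
    Σ (𝒫f (ℕ⁺ → ℕ⁺) → ℕ⁺) λ α →
    Σ (𝒫f (ℕ⁺ → ℕ⁺) → 𝒫f ℕ⁺) λ H →
    Congruent _≋_ _≡_ α ×
    Congruent _≋_ _≋_ H ×
    (∀ G K → G ⊊f K → H G <f H K) ×
    ((G : ℕ⁺ → 𝒫f (ℕ⁺ → ℕ⁺)) → (∀ i → G i ⊊f G (suc⁺ i)) →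
    (β : Fin (suc k) → 𝒫f ℕ⁺) → (∀ (j : Fin k) → β (inject₁ j) <f β (suc j)) →
    (f : ℕ⁺ → ℕ⁺ → ℕ⁺) → (∀ i → f i ∈f G i) →
    (P : Fin (suc k) → ℙ) → (∀ j → P j ∈f T) →
    (λ j → + (∑[ i ∈ β j ] val (α (G i)))
    + eval (P j) (+ (∑[ i ∈ β j ] ∑[ t ∈ H (G i) ] val (f i t))))
    ∈ℤ^ A)
corollary1p28 em ext k p hyp A p⨂∋A T =
  -- Both functions read the enumeration of a chosen representative, hence depend only on the set.
  α₀ ∘ members , H₀ ∘ members ,
  (λ {G} {K} G≋K → cong α₀ (members-cong {G} {K} G≋K)) ,
  (λ {G} {K} G≋K → subst (λ F → H₀ (members G) ≋ H₀ F) (members-cong {G} {K} G≋K)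
                     ((λ {x} x∈ → x∈) , (λ {x} x∈ → x∈))) ,
  (λ G K G⊊K → H₀-increasing (members-⊆ G K G⊊K) (members-< G K G⊊K)) ,
  λ G step β β< f f∈ P P∈ →
    Walk.walk (members ∘ G)
      (λ {i} {j} i<j → members-⊆ (G i) (G j) (⊊f-chain G step i<j))
      (λ {i} {j} i<j → members-< (G i) (G j) (⊊f-chain G step i<j))
      f (λ i → proj₂ (representative-≋ ext (G i)) (f∈ i))
      β β< P P∈
  where
  open Sets em

  idempotent : Idempotent p
  idempotent = [ proj₁ , proj₁ ]′ hyp

  p∈𝒥p : p ∈ 𝒥p
  p∈𝒥p = [ Minimal.minimal⇒𝒥p em {p} , proj₂ ]′ hyp

  open Construction {k} {p} idempotent (λ {B} p∋B → JpSet⇒JpList (p∈𝒥p B p∋B)) {A} p⨂∋A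
    (toList (elements T))

  members : 𝒫f (ℕ⁺ → ℕ⁺) → List (ℕ⁺ → ℕ⁺)
  members = toList ∘ elements ∘ representative ext

  members-cong : ∀ {G K} → G ≋ K → members G ≡ members K
  members-cong {G} {K} G≋K = cong (toList ∘ elements) (representative-cong ext {G} {K} G≋K)

  representative-⊊ : ∀ G K → G ⊊f K → representative ext G ⊊f representative ext K
  representative-⊊ G K (G⊆K , K⊈G) =
    (λ {x} x∈ → proj₂ K≋ {x} (G⊆K (proj₁ G≋ {x} x∈))) ,
    λ K⊆G → K⊈G λ {x} x∈ → proj₁ G≋ {x} (K⊆G (proj₂ K≋ {x} x∈))
    where
    G≋ = representative-≋ ext G
    K≋ = representative-≋ ext K

  members-⊆ : ∀ G K → G ⊊f K → ∀ {x} → x ∈ₗ members G → x ∈ₗ members K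
  members-⊆ G K G⊊K = proj₁ (representative-⊊ G K G⊊K)

  members-< : ∀ G K → G ⊊f K → length (members G) < length (members K)
  members-< G K G⊊K = ⊊f⇒length< (representative ext G) (representative ext K) (representative-⊊ G K G⊊K)
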